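{- For any integers $d\ge2$ and $h\ge0$, the sequence $(\mathsf{N}_{d,h,k})_{k\in\mathbb{Z}}$ is symmetric and strictly unimodal. For any integers $d\ge2$ and $h\ge0$, the sequences $(\mathsf{N}^{(1)}_{d,h,k})_{k\in\mathbb{Z}}$ and $(\mathsf{N}^{(3)}_{d,h,k})_{k\in\mathbb{Z}}$ are symmetric and unimodal.
   Context: Let $y=-e^{2\pi iz}$, $q=e^{2\pi i\tau}$, $(a;q)_\infty=\prod_{j\ge0}(1-aq^j)$, $(a,b,c;q)_\infty=(a;q)_\infty(b;q)_\infty(c;q)_\infty$, $\eta(\tau)=q^{1/24}(q;q)_\infty$ and $\vartheta_1(z,\tau)=q^{1/8}(y^{ -1/2}+y^{1/2})(q,-yq,-y^{ -1}q;q)_\infty$. Let $G(z,\tau)=\eta(\tau)^{ -6}\vartheta_1(z,\tau)^2\left(y\frac{d}{dy}\right)^2\log\vartheta_1(z,\tau)$. The numbers $\mathsf{N}_{d,h,k},\mathsf{N}^{(1)}_{d,h,k},\mathsf{N}^{(3)}_{d,h,k}$ (genus $0$ Gromov–Witten invariants of the Hilbert scheme of $d$ points of an elliptic K3 surface) are defined by the expansions $$\sum_{h\ge0}\sum_{k}\mathsf{N}_{d,h,k}y^kq^{h-1}=\eta^{ -24}\Big(\frac{\vartheta_1}{\eta^3}\Big)^{2d-2},\quad \sum_{h\ge0}\sum_k\mathsf{N}^{(1)}_{d,h,k}y^kq^{h-1}=\eta^{ -24}G^{d-1},$$ $$\sum_{h\ge0}\sum_k\mathsf{N}^{(3)}_{d,h,k}y^kq^{h-1}=\frac1d\binom{2d-2}{d-1}\eta^{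 -24}\,q\frac{d}{dq}G^{d-1}.$$ A two-sided sequence with finitely many nonzero terms is symmetric if its $k$-th and $(-k)$-th terms agree, and unimodal (resp. strictly unimodal) if, restricted to the smallest interval of indices containing all nonzero terms, it first weakly (resp. strictly) increases and then weakly (resp. strictly) decreases. -}

module Defs where

open import Data.Nat as ℕ using (ℕ; zero; suc)
open import Data.Nat.Divisibility using (_∣?_)
open import Data.Nat.Combinatorics using (_C_)
open import Data.Integer as ℤ using (ℤ; +_; -[1+_]; 0ℤ; 1ℤ)
open import Data.List using (List; []; _∷_; _++_; replicate; map)
open import Data.Product using (_×_; Σ; ∃; _,_)
open import Relation.Nullary using (¬_; does)
open import Relation.Binary.PropositionalEquality using (_≡_)
open import Data.Bool using (if_then_else_)

-- Polynomials in y (coefficient lists, lowest degree first)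

addL : List ℤ → List ℤ → List ℤ
addL [] ys = ys
addL xs [] = xs
addL (x ∷ xs) (y ∷ ys) = (x ℤ.+ y) ∷ addL xs ys

scaleL : ℤ → List ℤ → List ℤ
scaleL c = map (c ℤ.*_)

mulL : List ℤ → List ℤ → List ℤ
mulL [] ys = []
mulL (x ∷ xs) ys = addL (scaleL x ys) (0ℤ ∷ mulL xs ys)

nth : List ℤ → ℕ → ℤ
nth [] _ = 0ℤ
nth (x ∷ xs) zero = x
nth (x ∷ xs) (suc n) = nth xs n

-- Laurent polynomials in y:  mkLP e [c₀,c₁,…] = Σᵢ cᵢ y^(e+i)

record LPoly : Set where
  constructor mkLP
  field
    low : ℤ
    cs  : List ℤ
open LPoly public

coeffLP : LPoly → ℤ → ℤ
coeffLP p k with k ℤ.- low p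
... | + n = nth (cs p) n
... | -[1+ _ ] = 0ℤ

0LP 1LP : LPoly
0LP = mkLP 0ℤ []
1LP = mkLP 0ℤ (1ℤ ∷ [])

mono : ℤ → ℤ → LPoly
mono c k = mkLP k (c ∷ [])

_+LP_ : LPoly → LPoly → LPoly
p +LP q = mkLP m (addL (replicate ℤ.∣ low p ℤ.- m ∣ 0ℤ ++ cs p)
                        (replicate ℤ.∣ low q ℤ.- m ∣ 0ℤ ++ cs q))
  where m = low p ℤ.⊓ low q

_*LP_ : LPoly → LPoly → LPoly
p *LP q = mkLP (low p ℤ.+ low q) (mulL (cs p) (cs q))

scaleLP : ℤ → LPoly → LPoly
scaleLP c p = mkLP (low p) (scaleL c (cs p))

DyAux : ℤ → List ℤ → List ℤ
DyAux e [] = []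
DyAux e (c ∷ cs) = (e ℤ.* c) ∷ DyAux (e ℤ.+ 1ℤ) cs

DyLP : LPoly → LPoly
DyLP p = mkLP (low p) (DyAux (low p) (cs p))

-- Formal power series in q with Laurent-polynomial coefficients in y:
-- f n = coefficient of q^n

PS : Set
PS = ℕ → LPoly

sumLP : ℕ → (ℕ → LPoly) → LPoly
sumLP zero f = 0LP
sumLP (suc n) f = sumLP n f +LP f n

_+S_ : PS → PS → PS
(f +S g) n = f n +LP g n

_*S_ : PS → PS → PS
(f *S g) n = sumLP (suc n) (λ i → f i *LP g (n ℕ.∸ i))

constS : LPoly → PS
constS c zero = c
constS c (suc n) = 0LP

1S : PS
1S = constS 1LP

scaleS : ℤ → PS → PS
scaleS c f n = scaleLP c (f n)

_^S_ : PS → ℕ → PS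
f ^S zero = 1S
f ^S suc n = f *S (f ^S n)

DyS : PS → PS
DyS f n = DyLP (f n)

DqS : PS → PS
DqS f n = scaleLP (+ n) (f n)

onePlus : LPoly → ℕ → PS
onePlus c j zero = 1LP
onePlus c j (suc n) = if does (suc n ℕ.≟ j) then c else 0LP

-- geometric series 1/(1 - q^j) = Σ_m q^(j m)   (j ≥ 1)
geomS : ℕ → PS
geomS j n = if does (j ∣? n) then 1LP else 0LP

finProd : (ℕ → PS) → ℕ → PS
finProd F zero = 1S
finProd F (suc m) = finProd F m *S F (suc m)

-- infinite product ∏_{j≥1} F j, valid when F j ≡ 1 mod q^j
-- (then the q^n coefficient only depends on F 1, …, F n)
infProd : (ℕ → PS) → PS
infProd F n = finProd F n n

qPochInv : PS
qPochInv = infProd geomS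

-- T = y^{1/2} q^{-1/8} ϑ₁ = (1+y) (q, -yq, -y⁻¹q; q)_∞
thetaT : PS
thetaT = constS (mkLP 0ℤ (1ℤ ∷ 1ℤ ∷ [])) *S
  infProd (λ j → (onePlus (mono (ℤ.- 1ℤ) 0ℤ) j *S onePlus (mono 1ℤ 1ℤ) j)
                   *S onePlus (mono 1ℤ (ℤ.- 1ℤ)) j)

-- q·η⁻²⁴ = 1/(q;q)_∞^24
qEtaInv24 : PS
qEtaInv24 = qPochInv ^S 24

-- (ϑ₁/η³)^(2d-2) = y^{-(d-1)} (T/(q;q)³)^(2d-2)
thetaRatioPow : ℕ → PS
thetaRatioPow d = constS (mono 1ℤ (ℤ.- (+ (d ℕ.∸ 1))))
  *S ((thetaT *S (qPochInv ^S 3)) ^S (2 ℕ.* d ℕ.∸ 2))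

-- G = η⁻⁶ ϑ₁² (y d/dy)² log ϑ₁ = η⁻⁶ (ϑ₁ D²ϑ₁ − (Dϑ₁)²)
--   = y⁻¹ (q;q)_∞⁻⁶ (T D²T − (DT)²)
Gser : PS
Gser = constS (mono 1ℤ (ℤ.- 1ℤ)) *S ((qPochInv ^S 6) *S
  ((thetaT *S DyS (DyS thetaT)) +S scaleS (ℤ.- 1ℤ) (DyS thetaT *S DyS thetaT)))

catFactor : ℕ → ℕ
catFactor zero = 0
catFactor (suc m) = ((2 ℕ.* m) C m) ℕ./ suc m

-- the invariants: N d h k = coefficient of y^k q^(h-1) in the defining series
N : ℕ → ℕ → ℤ → ℤ
N d h k = coeffLP ((qEtaInv24 *S thetaRatioPow d) h) k

N1 : ℕ → ℕ → ℤ → ℤ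
N1 d h k = coeffLP ((qEtaInv24 *S (Gser ^S (d ℕ.∸ 1))) h) k

N3 : ℕ → ℕ → ℤ → ℤ
N3 d h k = coeffLP ((scaleS (+ catFactor d) (qEtaInv24 *S DqS (Gser ^S (d ℕ.∸ 1)))) h) k

Symmetric : (ℤ → ℤ) → Set
Symmetric a = ∀ k → a k ≡ a (ℤ.- k)

InSupportHull : (ℤ → ℤ) → ℤ → Set
InSupportHull a k = (∃ λ l → l ℤ.≤ k × ¬ (a l ≡ 0ℤ)) × (∃ λ r → k ℤ.≤ r × ¬ (a r ≡ 0ℤ))

Unimodal : (ℤ → ℤ) → Set
Unimodal a = ∃ λ m →
  (∀ i j → InSupportHull a i → InSupportHull a j → i ℤ.< j → j ℤ.≤ m → a i ℤ.≤ a j) ×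
  (∀ i j → InSupportHull a i → InSupportHull a j → i ℤ.< j → m ℤ.≤ i → a j ℤ.≤ a i)

StrictlyUnimodal : (ℤ → ℤ) → Set
StrictlyUnimodal a = ∃ λ m →
  (∀ i j → InSupportHull a i → InSupportHull a j → i ℤ.< j → j ℤ.≤ m → a i ℤ.< a j) ×
  (∀ i j → InSupportHull a i → InSupportHull a j → i ℤ.< j → m ℤ.≤ i → a j ℤ.< a i)

{-# OPTIONS --safe #-}
module Submission where

-- Put s = y + 2 + y⁻¹, w = s (y + y⁻¹) and x = q^j.  Since
-- (1 + yx)(1 + y⁻¹x) / (1 - x)² = 1 + s x / (1 - x)²,
-- the coefficients of ϑ₁² / η⁶ are polynomials in s with nonnegative integer coefficients.
-- The operator H f = f D²f - (Df)² = f² D² log f, where D = y d/dy, satisfies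
-- H (f g) = g² H f + f² H g and H (1 + t) = t for t = y, yx, y⁻¹x, so H of the theta product is
-- a sum over its factors.  The factor j contributes to G = y⁻¹ (q;q)⁻⁶ H T a nonnegative
-- combination of s and w, because
-- s (y (1 + y⁻¹x)² + y⁻¹ (1 + yx)²) = w (1 + x²) + 4 s x.
-- Multiplication by s preserves the symmetric sequences that strictly decrease away from 0 down
-- to 0, and multiplication by s or by w preserves the symmetric unimodal nonnegative ones.

-- Multiplication by y + y⁻¹ alone destroys unimodality, so the contribution of each factor j to H
-- needs an extra s. It comes from the prefactor 1 + y of the theta product, since y⁻¹ (1 + y)² = s;
-- the summand of H belonging to the prefactor itself needs none, because H (1 + y) = y is cancelled
-- by y⁻¹. As w has coefficients 1, 2, 2, 2, 1, it does not preserve strict decrease, which is why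
-- the argument for G yields only weak unimodality. The theta factors have negative coefficients;
-- nonnegativity appears only after each is matched with its share of the powers of 1 / (q;q). The
-- identities behind this are proved in an abstract commutative semiring with a derivation, and
-- positivity is an abstract predicate closed under sums and products, instantiated once for each
-- shape. A Laurent polynomial counts as positive when convolution with it preserves the shape, so
-- closure under products is composition of operators. Only the coefficient of q^h is read off, so
-- series are compared modulo q^(h+1), where the infinite products become finite.

open import Defs
open import Algebra.Bundles using (CommutativeSemiring)
open import Algebra.Structures.Biased using (isCommutativeSemiringˡ)
open import Data.Nat as ℕ using (ℕ; zero; suc; _≤_)
open import Level using (0ℓ)

-- The second logarithmic derivative of a theta product

module _ (R : CommutativeSemiring 0ℓ 0ℓ) where
  open CommutativeSemiring R

  -- Negation enters only as a right inverse. Identities are made subtraction-free by cancellation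
  -- and then checked in the semiring, where the solver with natural coefficients applies.
  record IsDerivation (neg D : Carrier → Carrier) : Set where
    field
      neg-inverseʳ : ∀ f → f + neg f ≈ 0#
      D-cong : ∀ {f g} → f ≈ g → D f ≈ D g
      D-+ : ∀ f g → D (f + g) ≈ D f + D g
      D-* : ∀ f g → D (f * g) ≈ D f * g + f * D g

module LogDerivative (R : CommutativeSemiring 0ℓ 0ℓ)
  {neg D : CommutativeSemiring.Carrier R → CommutativeSemiring.Carrier R}
  (isDerivation : IsDerivation R neg D)
  where

  open CommutativeSemiring R
  open IsDerivation isDerivation
  open import Algebra.Solver.Ring.NaturalCoefficients.Default R
  open import Relation.Binary.Reasoning.Setoid setoid

  +-cancelʳ-≈ : ∀ {f g} k → f + k ≈ g + k → f ≈ g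
  +-cancelʳ-≈ {f} {g} k e = trans (sym (cancel f)) (trans (+-congʳ e) (cancel g))
    where
    cancel : ∀ f → (f + k) + neg k ≈ f
    cancel f = trans (+-assoc f k (neg k)) (trans (+-congˡ (neg-inverseʳ k)) (+-identityʳ f))

  -- H f = f² D² log f
  H : Carrier → Carrier
  H f = f * D (D f) + neg (D f * D f)

  H-spec : ∀ f → H f + D f * D f ≈ f * D (D f)
  H-spec f = begin
    (f * D (D f) + neg (D f * D f)) + D f * D f  ≈⟨ +-assoc _ _ _ ⟩
    f * D (D f) + (neg (D f * D f) + D f * D f)  ≈⟨ +-congˡ (trans (+-comm _ _) (neg-inverseʳ _)) ⟩
    f * D (D f) + 0#                             ≈⟨ +-identityʳ _ ⟩
    f * D (D f)                                  ∎

  -- Every formula for `H` below goes through this: adding (Df)² removes the subtraction from the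
  -- claim.
  H-unique : ∀ {f h} → h + D f * D f ≈ f * D (D f) → H f ≈ h
  H-unique {f} e = +-cancelʳ-≈ (D f * D f) (trans (H-spec f) (sym e))

  H-cong : ∀ {f g} → f ≈ g → H f ≈ H g
  H-cong {f} {g} e = H-unique (begin
    H g + D f * D f  ≈⟨ +-congˡ (*-cong (D-cong e) (D-cong e)) ⟩
    H g + D g * D g  ≈⟨ H-spec g ⟩
    g * D (D g)      ≈⟨ *-cong e (D-cong (D-cong e)) ⟨
    f * D (D f)      ∎)

  -- With H f = f² D² log f this is additivity of the logarithm, multiplied by f² g².
  H-* : ∀ f g → H (f * g) ≈ (g * g) * H f + (f * f) * H g
  H-* f g = H-unique (begin
    ((g * g) * H f + (f * f) * H g) + D (f * g) * D (f * g)
      ≈⟨ +-congˡ (*-cong (D-* f g) (D-* f g)) ⟩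
    ((g * g) * H f + (f * f) * H g) + (D f * g + f * D g) * (D f * g + f * D g)
      -- The cross terms 2 f g Df Dg are set aside, so that `H-spec` applies to each
      -- `H f + D f * D f`.
      ≈⟨ solve 6 (λ f g a b d e →
           ((g :* g) :* a :+ (f :* f) :* b) :+ (d :* g :+ f :* e) :* (d :* g :+ f :* e)
           := ((g :* g) :* (a :+ d :* d) :+ (f :* f) :* (b :+ e :* e)) :+ (d :* e :+ d :* e) :* (f :* g))
           refl f g (H f) (H g) (D f) (D g) ⟩
    ((g * g) * (H f + D f * D f) + (f * f) * (H g + D g * D g)) + (D f * D g + D f * D g) * (f * g)
      ≈⟨ +-congʳ (+-cong (*-congˡ (H-spec f)) (*-congˡ (H-spec g))) ⟩
    ((g * g) * (f * D (D f)) + (f * f) * (g * D (D g))) + (D f * D g + D f * D g) * (f * g)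
      ≈⟨ solve 6 (λ f g d e d₂ e₂ →
           ((g :* g) :* (f :* d₂) :+ (f :* f) :* (g :* e₂)) :+ (d :* e :+ d :* e) :* (f :* g)
           := (f :* g) :* ((d₂ :* g :+ d :* e) :+ (d :* e :+ f :* e₂)))
           refl f g (D f) (D g) (D (D f)) (D (D g)) ⟩
    (f * g) * ((D (D f) * g + D f * D g) + (D f * D g + f * D (D g)))
      ≈⟨ *-congˡ (+-cong (D-* (D f) g) (D-* f (D g))) ⟨
    (f * g) * (D (D f * g) + D (f * D g))
      ≈⟨ *-congˡ (D-+ _ _) ⟨
    (f * g) * D (D f * g + f * D g)
      ≈⟨ *-congˡ (D-cong (D-* f g)) ⟨
    (f * g) * D (D (f * g)) ∎)

  D-1 : D 1# ≈ 0#
  D-1 = +-cancelʳ-≈ (D 1#) (begin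
    D 1# + D 1#            ≈⟨ +-cong (*-identityʳ _) (*-identityˡ _) ⟨
    D 1# * 1# + 1# * D 1#  ≈⟨ D-* 1# 1# ⟨
    D (1# * 1#)            ≈⟨ D-cong (*-identityˡ 1#) ⟩
    D 1#                   ≈⟨ +-identityˡ _ ⟨
    0# + D 1#              ∎)

  D-0 : D 0# ≈ 0#
  D-0 = +-cancelʳ-≈ (D 0#) (trans (sym (D-+ 0# 0#)) (trans (D-cong (+-identityˡ 0#)) (sym (+-identityˡ _))))

  H-constant : ∀ {f} → D f ≈ 0# → H f ≈ 0#
  H-constant {f} e = H-unique (begin
    0# + D f * D f  ≈⟨ +-identityˡ _ ⟩
    D f * D f       ≈⟨ *-congʳ e ⟩
    0# * D f        ≈⟨ zeroˡ _ ⟩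
    0#              ≈⟨ zeroʳ f ⟨
    f * 0#          ≈⟨ *-congˡ (trans (D-cong e) D-0) ⟨
    f * D (D f)     ∎)

  -- The computation is (1 + t) t - t² = t. The hypotheses do not see the sign of the weight, so
  -- they cover weights 1 and -1 in y alike.
  H-1+ : ∀ {t} → D (D t) ≈ t → D t * D t ≈ t * t → H (1# + t) ≈ t
  H-1+ {t} e₂ e₁ = H-unique (begin
    t + D (1# + t) * D (1# + t)  ≈⟨ +-congˡ (*-cong D-1+t D-1+t) ⟩
    t + D t * D t                ≈⟨ +-congˡ e₁ ⟩
    t + t * t                    ≈⟨ solve 1 (λ t → t :+ t :* t := (con 1 :+ t) :* t) refl t ⟩
    (1# + t) * t                 ≈⟨ *-congˡ (trans (D-cong D-1+t) e₂) ⟨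
    (1# + t) * D (D (1# + t))    ∎)
    where
    D-1+t : D (1# + t) ≈ D t
    D-1+t = trans (D-+ 1# t) (trans (+-congʳ D-1) (+-identityˡ _))

  H-1+-weight+1 : ∀ {t} → D t ≈ t → H (1# + t) ≈ t
  H-1+-weight+1 e = H-1+ (trans (D-cong e) e) (*-cong e e)

  -- Weight -1 is the equation t + Dt = 0. Applying D to it gives D²t = t; multiplying it by Dt and
  -- by t and comparing gives (Dt)² = t².
  H-1+-weight-1 : ∀ {t} → t + D t ≈ 0# → H (1# + t) ≈ t
  H-1+-weight-1 {t} e = H-1+ (+-cancelʳ-≈ (D t) D²t+Dt) (+-cancelʳ-≈ (t * D t) (begin
    D t * D t + t * D t  ≈⟨ solve 2 (λ t d → d :* d :+ t :* d := (t :+ d) :* d) refl t (D t) ⟩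
    (t + D t) * D t      ≈⟨ *-congʳ e ⟩
    0# * D t             ≈⟨ zeroˡ _ ⟩
    0#                   ≈⟨ zeroʳ t ⟨
    t * 0#               ≈⟨ *-congˡ e ⟨
    t * (t + D t)        ≈⟨ distribˡ t t (D t) ⟩
    t * t + t * D t      ∎))
    where
    D²t+Dt : D (D t) + D t ≈ t + D t
    D²t+Dt = begin
      D (D t) + D t  ≈⟨ +-comm _ _ ⟩
      D t + D (D t)  ≈⟨ D-+ t (D t) ⟨
      D (t + D t)    ≈⟨ D-cong e ⟩
      D 0#           ≈⟨ D-0 ⟩
      0#             ≈⟨ e ⟨
      t + D t        ∎

  -- `P` will be positivity of a series. `P w` is an argument of the statements about `H` instead of
  -- a closure hypothesis, so that the module also serves the strict shape, which multiplication by
  -- w does not preserve.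
  module Theta (y v : Carrier) (yv≈1 : y * v ≈ 1#) (Dy≈y : D y ≈ y) (v+Dv≈0 : v + D v ≈ 0#)
    (P : Carrier → Set) (P-resp : ∀ {f g} → f ≈ g → P f → P g)
    (P-+ : ∀ {f g} → P f → P g → P (f + g)) (P-* : ∀ {f g} → P f → P g → P (f * g))
    (P-0 : P 0#) (P-1 : P 1#) (P-s : P ((1# + y) * (1# + v)))
    where

    s w : Carrier
    s = (1# + y) * (1# + v)
    w = s * (y + v)

    cube square : Carrier → Carrier
    cube f = f * (f * f)
    square f = f * f

    -- This turns the squared prefactor of the theta product into the s that the later summands
    -- require.
    v[1+y]²≈s : v * square (1# + y) ≈ s
    v[1+y]²≈s = begin
      v * ((1# + y) * (1# + y))
        ≈⟨ solve 2 (λ y v → v :* ((con 1 :+ y) :* (con 1 :+ y))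
             := (con 1 :+ y) :* (y :* v :+ v)) refl y v ⟩
      (1# + y) * (y * v + v)  ≈⟨ *-congˡ (+-congʳ yv≈1) ⟩
      s                       ∎

    -- x, z and g stand for q ^ j, 1 - q ^ j and 1 / (1 - q ^ j).
    module Factor {x z g : Carrier} (z+x≈1 : z + x ≈ 1#) (gz≈1 : g * z ≈ 1#) (Dx≈0 : D x ≈ 0#)
      (P-x : P x) (P-g : P g) where

      L : Carrier
      L = (z * (1# + y * x)) * (1# + v * x)

      z²+2x≈1+x² : z * z + (x + x) ≈ 1# + x * x
      z²+2x≈1+x² = begin
        z * z + (x + x)
          -- Multiplying x by z + x = 1 makes the identity homogeneous of degree 2, hence a
          -- polynomial identity.
          ≈⟨ +-congˡ (+-cong x≈x[z+x] x≈x[z+x]) ⟩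
        z * z + (x * (z + x) + x * (z + x))
          ≈⟨ solve 2 (λ x z → z :* z :+ (x :* (z :+ x) :+ x :* (z :+ x))
               := (z :+ x) :* (z :+ x) :+ x :* x) refl x z ⟩
        (z + x) * (z + x) + x * x
          ≈⟨ +-congʳ (trans (*-cong z+x≈1 z+x≈1) (*-identityˡ 1#)) ⟩
        1# + x * x ∎
        where
        x≈x[z+x] : x ≈ x * (z + x)
        x≈x[z+x] = sym (trans (*-congˡ z+x≈1) (*-identityʳ x))

      -- One copy of `g` cancels the `z` inside `L`, and the other two supply the denominator (1 -
      -- x)². This is why one theta series is paired with exactly three powers of 1 / (q;q).
      g³L≈1+sxg² : cube g * L ≈ 1# + s * (x * (g * g))
      g³L≈1+sxg² = begin
        cube g * L
          ≈⟨ solve 5 (λ y v x z g →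
               (g :* (g :* g)) :* ((z :* (con 1 :+ y :* x)) :* (con 1 :+ v :* x))
               := (g :* z) :* ((g :* g) :* ((con 1 :+ (y :* v) :* (x :* x)) :+ (y :+ v) :* x)))
               refl y v x z g ⟩
        (g * z) * ((g * g) * ((1# + (y * v) * (x * x)) + (y + v) * x))
          ≈⟨ *-cong gz≈1 (*-congˡ (+-congʳ (+-congˡ (trans (*-congʳ yv≈1) (*-identityˡ _))))) ⟩
        1# * ((g * g) * ((1# + x * x) + (y + v) * x))
          ≈⟨ trans (*-identityˡ _) (*-congˡ (+-congʳ (sym z²+2x≈1+x²))) ⟩
        (g * g) * ((z * z + (x + x)) + (y + v) * x)
          ≈⟨ solve 5 (λ y v x z g →
               (g :* g) :* ((z :* z :+ (x :+ x)) :+ (y :+ v) :* x)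
               := (g :* z) :* (g :* z) :+ ((con 1 :+ y :+ v) :+ con 1) :* (x :* (g :* g)))
               refl y v x z g ⟩
        (g * z) * (g * z) + ((1# + y + v) + 1#) * (x * (g * g))
          -- The constant 2 in y + 2 + v is read as 1 + y v, so that s appears in factored form.
          ≈⟨ +-cong (trans (*-cong gz≈1 gz≈1) (*-identityˡ 1#)) (*-congʳ (+-congˡ (sym yv≈1))) ⟩
        1# + ((1# + y + v) + y * v) * (x * (g * g))
          ≈⟨ solve 5 (λ y v x z g →
               con 1 :+ ((con 1 :+ y :+ v) :+ y :* v) :* (x :* (g :* g))
               := con 1 :+ ((con 1 :+ y) :* (con 1 :+ v)) :* (x :* (g :* g)))
               refl y v x z g ⟩
        1# + s * (x * (g * g)) ∎

      P-g³L : P (cube g * L)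
      P-g³L = P-resp (sym g³L≈1+sxg²) (P-+ P-1 (P-* P-s (P-* P-x (P-* P-g P-g))))

      Dz≈0 : D z ≈ 0#
      Dz≈0 = begin
        D z        ≈⟨ +-identityʳ _ ⟨
        D z + 0#   ≈⟨ +-congˡ Dx≈0 ⟨
        D z + D x  ≈⟨ D-+ z x ⟨
        D (z + x)  ≈⟨ D-cong z+x≈1 ⟩
        D 1#       ≈⟨ D-1 ⟩
        0#         ∎

      D-*x : ∀ t → D (t * x) ≈ D t * x
      D-*x t = trans (D-* t x) (trans (+-congˡ (trans (*-congˡ Dx≈0) (zeroʳ t))) (+-identityʳ _))

      H-L : H L ≈ (z * z) * (((1# + v * x) * (1# + v * x)) * (y * x) + ((1# + y * x) * (1# + y * x)) * (v * x))
      H-L = begin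
        H ((z * a) * b)                                    ≈⟨ H-* (z * a) b ⟩
        (b * b) * H (z * a) + ((z * a) * (z * a)) * H b    ≈⟨ +-cong (*-congˡ H-za) (*-congˡ H-b) ⟩
        (b * b) * ((z * z) * (y * x)) + ((z * a) * (z * a)) * (v * x)
          ≈⟨ solve 5 (λ a b z p q → (b :* b) :* ((z :* z) :* p) :+ ((z :* a) :* (z :* a)) :* q
               := (z :* z) :* ((b :* b) :* p :+ (a :* a) :* q)) refl a b z (y * x) (v * x) ⟩
        (z * z) * ((b * b) * (y * x) + (a * a) * (v * x))  ∎
        where
        a = 1# + y * x
        b = 1# + v * x
        H-za : H (z * a) ≈ (z * z) * (y * x)
        H-za = begin
          H (z * a)                          ≈⟨ H-* z a ⟩
          (a * a) * H z + (z * z) * H a      ≈⟨ +-cong (*-congˡ (H-constant Dz≈0))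
                                                  (*-congˡ (H-1+-weight+1 (trans (D-*x y) (*-congʳ Dy≈y)))) ⟩
          (a * a) * 0# + (z * z) * (y * x)   ≈⟨ trans (+-congʳ (zeroʳ _)) (+-identityˡ _) ⟩
          (z * z) * (y * x)                  ∎
        H-b : H b ≈ v * x
        H-b = H-1+-weight-1 (begin
          v * x + D (v * x)  ≈⟨ +-congˡ (D-*x v) ⟩
          v * x + D v * x    ≈⟨ distribʳ x v (D v) ⟨
          (v + D v) * x      ≈⟨ *-congʳ v+Dv≈0 ⟩
          0# * x             ≈⟨ zeroˡ x ⟩
          0#                 ∎)

      -- The factor z² of `H-L` cancels two of the six copies of `g`, which leaves g⁴; the s in
      -- front turns y + v into w.
      sg⁶H-L : s * (square (cube g) * H L) ≈
        (square (g * g) * x) * (w * (1# + x * x) + s * ((x + x) + (x + x)))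
      sg⁶H-L = begin
        s * (square (cube g) * H L)
          ≈⟨ *-congˡ (*-congˡ H-L) ⟩
        s * (square (cube g) * ((z * z) *
          (((1# + v * x) * (1# + v * x)) * (y * x) + ((1# + y * x) * (1# + y * x)) * (v * x))))
          ≈⟨ solve 6 (λ s y v x z g →
               s :* (((g :* (g :* g)) :* (g :* (g :* g))) :* ((z :* z) :*
                 (((con 1 :+ v :* x) :* (con 1 :+ v :* x)) :* (y :* x)
                   :+ ((con 1 :+ y :* x) :* (con 1 :+ y :* x)) :* (v :* x))))
               := ((g :* z) :* (g :* z)) :* ((((g :* g) :* (g :* g)) :* x) :*
                 (s :* ((y :+ v) :* (con 1 :+ (y :* v) :* (x :* x))
                   :+ (y :* v) :* ((x :+ x) :+ (x :+ x))))))
               refl s y v x z g ⟩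
        ((g * z) * (g * z)) * ((square (g * g) * x) *
          (s * ((y + v) * (1# + (y * v) * (x * x)) + (y * v) * ((x + x) + (x + x)))))
          ≈⟨ *-cong (trans (*-cong gz≈1 gz≈1) (*-identityˡ 1#)) (*-congˡ (*-congˡ (+-cong
               (*-congˡ (+-congˡ (trans (*-congʳ yv≈1) (*-identityˡ _))))
               (trans (*-congʳ yv≈1) (*-identityˡ _))))) ⟩
        1# * ((square (g * g) * x) * (s * ((y + v) * (1# + x * x) + ((x + x) + (x + x)))))
          ≈⟨ trans (*-identityˡ _) (*-congˡ (trans (distribˡ s _ _) (+-congʳ (sym (*-assoc s _ _))))) ⟩
        (square (g * g) * x) * (w * (1# + x * x) + s * ((x + x) + (x + x))) ∎

      P-sg⁶H-L : P w → P (s * (square (cube g) * H L))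
      P-sg⁶H-L P-w = P-resp (sym sg⁶H-L)
        (P-* (P-* (P-* (P-* P-g P-g) (P-* P-g P-g)) P-x)
          (P-+ (P-* P-w (P-+ P-1 (P-* P-x P-x))) (P-* P-s (P-+ (P-+ P-x P-x) (P-+ P-x P-x)))))

      P-ratio-step : ∀ {Q Z} → P (cube Q * Z) → P (cube (Q * g) * (Z * L))
      P-ratio-step {Q} {Z} p = P-resp
        (solve 4 (λ Q Z g L → ((Q :* (Q :* Q)) :* Z) :* ((g :* (g :* g)) :* L)
           := ((Q :* g) :* ((Q :* g) :* (Q :* g))) :* (Z :* L)) refl Q Z g L)
        (P-* p P-g³L)

      -- In H (Z L) = L² H Z + Z² H L the sixth power of Q g splits suitably for both terms: g⁶ L²
      -- and Q⁶ Z² are squares of positive ratios, and s goes to the factor that contains `H`.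
      P-H-step : ∀ {Q Z} → P w → P (cube Q * Z) → P (s * (square (cube Q) * H Z)) →
        P (s * (square (cube (Q * g)) * H (Z * L)))
      P-H-step {Q} {Z} P-w p h = P-resp (sym (begin
        s * (square (cube (Q * g)) * H (Z * L))
          ≈⟨ *-congˡ (*-congˡ (H-* Z L)) ⟩
        s * (square (cube (Q * g)) * ((L * L) * H Z + (Z * Z) * H L))
          ≈⟨ solve 7 (λ s Q g Z L a b →
               s :* (((Q :* g) :* ((Q :* g) :* (Q :* g))) :* ((Q :* g) :* ((Q :* g) :* (Q :* g)))
                 :* ((L :* L) :* a :+ (Z :* Z) :* b))
               := (s :* (((Q :* (Q :* Q)) :* (Q :* (Q :* Q))) :* a))
                    :* (((g :* (g :* g)) :* L) :* ((g :* (g :* g)) :* L))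
                  :+ (((Q :* (Q :* Q)) :* Z) :* ((Q :* (Q :* Q)) :* Z))
                    :* (s :* (((g :* (g :* g)) :* (g :* (g :* g))) :* b)))
               refl s Q g Z L (H Z) (H L) ⟩
        (s * (square (cube Q) * H Z)) * ((cube g * L) * (cube g * L))
          + ((cube Q * Z) * (cube Q * Z)) * (s * (square (cube g) * H L)) ∎))
        (P-+ (P-* h (P-* P-g³L P-g³L)) (P-* (P-* p p) (P-sg⁶H-L P-w)))

    -- Here `c e` is v^e and `p e` is f^(2e), given by recursions so that powers may come in any
    -- notation. Each v is paired with one f²: for theta series f is symmetric about exponent 1/2,
    -- and only v f² is symmetric about 0.
    P-even-power : ∀ {f} → P (v * square f) → ∀ {c p : ℕ → Carrier} →
      c 0 ≈ 1# → (∀ e → c (suc e) ≈ v * c e) →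
      p 0 ≈ 1# → (∀ e → p (suc e) ≈ f * (f * p e)) → ∀ e → P (c e * p e)
    P-even-power P-f c₀ c₊ p₀ p₊ zero    = P-resp (sym (*-cong c₀ p₀)) (P-* P-1 P-1)
    P-even-power {f} P-f {c} {p} c₀ c₊ p₀ p₊ (suc e) = P-resp (begin
      (v * (f * f)) * (c e * p e)  ≈⟨ solve 4 (λ v f c p → (v :* (f :* f)) :* (c :* p)
                                        := (v :* c) :* (f :* (f :* p))) refl v f (c e) (p e) ⟩
      (v * c e) * (f * (f * p e))  ≈⟨ *-cong (c₊ e) (p₊ e) ⟨
      c (suc e) * p (suc e)        ∎)
      (P-* P-f (P-even-power P-f c₀ c₊ p₀ p₊ e))

    -- Indexing starts at 0, so the factor with index j will be the one for q^(j+1).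
    ∏ : (ℕ → Carrier) → ℕ → Carrier
    ∏ F zero    = 1#
    ∏ F (suc m) = ∏ F m * F m

    module Product {x z g : ℕ → Carrier} (z+x≈1 : ∀ j → z j + x j ≈ 1#) (gz≈1 : ∀ j → g j * z j ≈ 1#)
      (Dx≈0 : ∀ j → D (x j) ≈ 0#) (P-x : ∀ j → P (x j)) (P-g : ∀ j → P (g j)) where

      module L (j : ℕ) = Factor (z+x≈1 j) (gz≈1 j) (Dx≈0 j) (P-x j) (P-g j)
      open L using (L) public

      P-ratio : ∀ m → P (cube (∏ g m) * ∏ L m)
      P-ratio zero    = P-* (P-* P-1 (P-* P-1 P-1)) P-1
      P-ratio (suc m) = L.P-ratio-step m (P-ratio m)

      P-H : P w → ∀ m → P (s * (square (cube (∏ g m)) * H (∏ L m)))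
      P-H P-w zero    = P-resp (sym (trans (*-congˡ (trans (*-congˡ (H-constant D-1)) (zeroʳ _))) (zeroʳ s))) P-0
      P-H P-w (suc m) = L.P-H-step m P-w (P-ratio m) (P-H P-w m)

      -- `Q` and `T` will be infinite products, equal to these finite ones only modulo a power of q.
      module _ (m : ℕ) {Q T : Carrier} (Q≈ : Q ≈ ∏ g m) (T≈ : T ≈ (1# + y) * ∏ L m) where

        cube≈ : cube Q ≈ cube (∏ g m)
        cube≈ = *-cong Q≈ (*-cong Q≈ Q≈)

        P-ratio² : P (v * square (T * cube Q))
        P-ratio² = P-resp (sym (begin
          v * square (T * cube Q)
            ≈⟨ *-congˡ (*-cong (*-cong T≈ cube≈) (*-cong T≈ cube≈)) ⟩
          v * square (((1# + y) * Z) * C)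
            ≈⟨ solve 4 (λ v a Z C → v :* (((a :* Z) :* C) :* ((a :* Z) :* C))
                 := (v :* (a :* a)) :* ((C :* Z) :* (C :* Z))) refl v (1# + y) Z C ⟩
          (v * square (1# + y)) * ((C * Z) * (C * Z))
            ≈⟨ *-congʳ v[1+y]²≈s ⟩
          s * ((C * Z) * (C * Z)) ∎))
          (P-* P-s (P-* (P-ratio m) (P-ratio m)))
          where
          Z = ∏ L m
          C = cube (∏ g m)

        -- By `H-*` there are two terms: H (1 + y) = y meets v and leaves the square of the positive
        -- ratio, while v (1 + y)² = s is what `P-H` asks for in front of H of the remaining
        -- product.
        P-G : P w → P (v * (square (cube Q) * H T))
        P-G P-w = P-resp (sym (begin
          v * (square (cube Q) * H T)
            ≈⟨ *-congˡ (*-cong (*-cong cube≈ cube≈) (H-cong T≈)) ⟩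
          v * (square C * H ((1# + y) * Z))
            ≈⟨ *-congˡ (*-congˡ (trans (H-* (1# + y) Z) (+-congʳ (*-congˡ (H-1+-weight+1 Dy≈y))))) ⟩
          v * (square C * ((Z * Z) * y + ((1# + y) * (1# + y)) * H Z))
            ≈⟨ solve 6 (λ v y C Z a h → v :* ((C :* C) :* ((Z :* Z) :* y :+ (a :* a) :* h))
                 := (y :* v) :* ((C :* Z) :* (C :* Z)) :+ (v :* (a :* a)) :* ((C :* C) :* h))
                 refl v y C Z (1# + y) (H Z) ⟩
          (y * v) * ((C * Z) * (C * Z)) + (v * square (1# + y)) * (square C * H Z)
            ≈⟨ +-cong (trans (*-congʳ yv≈1) (*-identityˡ _)) (*-congʳ v[1+y]²≈s) ⟩
          (C * Z) * (C * Z) + s * (square C * H Z) ∎))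
          (P-+ (P-* (P-ratio m) (P-ratio m)) (P-H P-w m))
          where
          Z = ∏ L m
          C = cube (∏ g m)

open import Data.Integer as ℤ using (ℤ; +_; -[1+_]; 0ℤ; 1ℤ)
import Data.Integer.Properties as ℤₚ
open import Algebra.Properties.AbelianGroup ℤₚ.+-0-abelianGroup using () renaming (∙-cancelʳ to +-cancelʳ)
open import Data.Integer.Tactic.RingSolver using (solve-∀)
open import Data.List using (List; []; _∷_; _++_; replicate)
open import Data.Nat.Divisibility using (_∣_; _∣0; _∣?_; >⇒∤; ∣-refl; ∣m∣n⇒∣m+n; ∣m+n∣m⇒∣n)
import Data.Nat.Properties as ℕₚ
open import Data.Product using (_×_; _,_)
open import Relation.Nullary using (¬_; does; yes; no)
open import Relation.Nullary.Decidable using (dec-true; dec-false)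
open import Data.Bool using (true; false; if_then_else_)
open import Data.Empty using (⊥-elim)
open import Data.Sum as Sum using (_⊎_; inj₁; inj₂)
open import Relation.Binary.Structures using (IsEquivalence)
open import Relation.Binary.PropositionalEquality
  using (_≡_; refl; sym; trans; cong; cong₂; subst; subst₂; module ≡-Reasoning)

+-congˡ : ∀ i {j k} → j ≡ k → i ℤ.+ j ≡ i ℤ.+ k
+-congˡ i = cong (λ j → i ℤ.+ j)

-- Laurent polynomials as convolution operators on sequences

actL : List ℤ → (ℤ → ℤ) → ℤ → ℤ
actL []       a k = 0ℤ
actL (c ∷ cs) a k = c ℤ.* a k ℤ.+ actL cs a (k ℤ.- 1ℤ)

act : LPoly → (ℤ → ℤ) → ℤ → ℤ
act p a k = actL (cs p) a (k ℤ.- low p)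

actL-cong : ∀ xs {a b} → (∀ k → a k ≡ b k) → ∀ k → actL xs a k ≡ actL xs b k
actL-cong []       eq k = refl
actL-cong (x ∷ xs) eq k = cong₂ ℤ._+_ (cong (x ℤ.*_) (eq k)) (actL-cong xs eq (k ℤ.- 1ℤ))

actL-addL : ∀ xs ys a k → actL (addL xs ys) a k ≡ actL xs a k ℤ.+ actL ys a k
actL-addL []       ys       a k = sym (ℤₚ.+-identityˡ _)
actL-addL (x ∷ xs) []       a k = sym (ℤₚ.+-identityʳ _)
actL-addL (x ∷ xs) (y ∷ ys) a k =
  trans (+-congˡ ((x ℤ.+ y) ℤ.* a k) (actL-addL xs ys a (k ℤ.- 1ℤ))) (regroup x y (a k) _ _)
  where
  regroup : ∀ x y u v w →
    (x ℤ.+ y) ℤ.* u ℤ.+ (v ℤ.+ w) ≡ (x ℤ.* u ℤ.+ v) ℤ.+ (y ℤ.* u ℤ.+ w)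
  regroup = solve-∀

actL-scaleL : ∀ c xs a k → actL (scaleL c xs) a k ≡ c ℤ.* actL xs a k
actL-scaleL c []       a k = sym (ℤₚ.*-zeroʳ c)
actL-scaleL c (x ∷ xs) a k =
  trans (+-congˡ ((c ℤ.* x) ℤ.* a k) (actL-scaleL c xs a (k ℤ.- 1ℤ))) (regroup c x (a k) _)
  where
  regroup : ∀ c x u v → (c ℤ.* x) ℤ.* u ℤ.+ c ℤ.* v ≡ c ℤ.* (x ℤ.* u ℤ.+ v)
  regroup = solve-∀

actL-mulL : ∀ xs ys a k → actL (mulL xs ys) a k ≡ actL xs (actL ys a) k
actL-mulL []       ys a k = refl
actL-mulL (x ∷ xs) ys a k = begin
  actL (addL (scaleL x ys) (0ℤ ∷ mulL xs ys)) a k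
    ≡⟨ actL-addL (scaleL x ys) (0ℤ ∷ mulL xs ys) a k ⟩
  actL (scaleL x ys) a k ℤ.+ (0ℤ ℤ.+ actL (mulL xs ys) a (k ℤ.- 1ℤ))
    ≡⟨ cong₂ ℤ._+_ (actL-scaleL x ys a k)
         (trans (ℤₚ.+-identityˡ _) (actL-mulL xs ys a (k ℤ.- 1ℤ))) ⟩
  x ℤ.* actL ys a k ℤ.+ actL xs (actL ys a) (k ℤ.- 1ℤ) ∎
  where open ≡-Reasoning

actL-shift : ∀ xs a m k → actL xs (λ j → a (j ℤ.- m)) k ≡ actL xs a (k ℤ.- m)
actL-shift []       a m k = refl
actL-shift (x ∷ xs) a m k = +-congˡ (x ℤ.* a (k ℤ.- m))
  (trans (actL-shift xs a m (k ℤ.- 1ℤ)) (cong (actL xs a) (swap k m)))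
  where
  swap : ∀ k m → (k ℤ.- 1ℤ) ℤ.- m ≡ (k ℤ.- m) ℤ.- 1ℤ
  swap = solve-∀

actL-linear : ∀ xs c a b k →
  actL xs (λ j → c ℤ.* a j ℤ.+ b j) k ≡ c ℤ.* actL xs a k ℤ.+ actL xs b k
actL-linear []       c a b k = sym (trans (ℤₚ.+-identityʳ _) (ℤₚ.*-zeroʳ c))
actL-linear (x ∷ xs) c a b k =
  trans (+-congˡ (x ℤ.* (c ℤ.* a k ℤ.+ b k)) (actL-linear xs c a b (k ℤ.- 1ℤ)))
    (regroup x c (a k) (b k) _ _)
  where
  regroup : ∀ x c u v u′ v′ → x ℤ.* (c ℤ.* u ℤ.+ v) ℤ.+ (c ℤ.* u′ ℤ.+ v′)
    ≡ c ℤ.* (x ℤ.* u ℤ.+ u′) ℤ.+ (x ℤ.* v ℤ.+ v′)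
  regroup = solve-∀

actL-zero : ∀ xs k → actL xs (λ _ → 0ℤ) k ≡ 0ℤ
actL-zero []       k = refl
actL-zero (x ∷ xs) k = trans (cong₂ ℤ._+_ (ℤₚ.*-zeroʳ x) (actL-zero xs _)) refl

-- `actL (x ∷ xs)` is built from scaling and shifting, and `actL ys` commutes with both.
actL-comm : ∀ xs ys a k → actL xs (actL ys a) k ≡ actL ys (actL xs a) k
actL-comm []       ys a k = sym (actL-zero ys k)
actL-comm (x ∷ xs) ys a k = sym (begin
  actL ys (λ j → x ℤ.* a j ℤ.+ actL xs a (j ℤ.- 1ℤ)) k
    ≡⟨ actL-linear ys x a _ k ⟩
  x ℤ.* actL ys a k ℤ.+ actL ys (λ j → actL xs a (j ℤ.- 1ℤ)) k
    ≡⟨ +-congˡ (x ℤ.* actL ys a k)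
         (trans (actL-shift ys (actL xs a) 1ℤ k) (sym (actL-comm xs ys a (k ℤ.- 1ℤ)))) ⟩
  x ℤ.* actL ys a k ℤ.+ actL xs (actL ys a) (k ℤ.- 1ℤ) ∎)
  where open ≡-Reasoning

actL-pad : ∀ n xs a k → actL (replicate n 0ℤ ++ xs) a k ≡ actL xs a (k ℤ.- + n)
actL-pad zero    xs a k = cong (actL xs a) (sym (ℤₚ.+-identityʳ k))
actL-pad (suc n) xs a k = trans (ℤₚ.+-identityˡ _)
  (trans (actL-pad n xs a (k ℤ.- 1ℤ)) (cong (actL xs a) (assoc k (+ n))))
  where
  assoc : ∀ k m → (k ℤ.- 1ℤ) ℤ.- m ≡ k ℤ.- (1ℤ ℤ.+ m)
  assoc = solve-∀

-- The term of exponent e + i reads `a` at k - i, and (e + i) + (k - i) = k + e. This is a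
-- commutator identity with its negative half moved to the left.
actL-DyAux : ∀ e xs a k →
  actL (DyAux e xs) a k ℤ.+ actL xs (λ j → j ℤ.* a j) k ≡ (k ℤ.+ e) ℤ.* actL xs a k
actL-DyAux e []       a k = sym (ℤₚ.*-zeroʳ (k ℤ.+ e))
actL-DyAux e (x ∷ xs) a k = begin
  ((e ℤ.* x) ℤ.* a k ℤ.+ d) ℤ.+ (x ℤ.* (k ℤ.* a k) ℤ.+ d′)  ≡⟨ regroup e x (a k) k d d′ ⟩
  (k ℤ.+ e) ℤ.* (x ℤ.* a k) ℤ.+ (d ℤ.+ d′)
    ≡⟨ +-congˡ ((k ℤ.+ e) ℤ.* (x ℤ.* a k)) (actL-DyAux (e ℤ.+ 1ℤ) xs a (k ℤ.- 1ℤ)) ⟩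
  (k ℤ.+ e) ℤ.* (x ℤ.* a k) ℤ.+ ((k ℤ.- 1ℤ) ℤ.+ (e ℤ.+ 1ℤ)) ℤ.* actL xs a (k ℤ.- 1ℤ)
    ≡⟨ collect k e (x ℤ.* a k) _ ⟩
  (k ℤ.+ e) ℤ.* (x ℤ.* a k ℤ.+ actL xs a (k ℤ.- 1ℤ)) ∎
  where
  open ≡-Reasoning
  d  = actL (DyAux (e ℤ.+ 1ℤ) xs) a (k ℤ.- 1ℤ)
  d′ = actL xs (λ j → j ℤ.* a j) (k ℤ.- 1ℤ)
  regroup : ∀ e x u k d d′ → ((e ℤ.* x) ℤ.* u ℤ.+ d) ℤ.+ (x ℤ.* (k ℤ.* u) ℤ.+ d′)
    ≡ (k ℤ.+ e) ℤ.* (x ℤ.* u) ℤ.+ (d ℤ.+ d′)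
  regroup = solve-∀
  collect : ∀ k e u v →
    (k ℤ.+ e) ℤ.* u ℤ.+ ((k ℤ.- 1ℤ) ℤ.+ (e ℤ.+ 1ℤ)) ℤ.* v ≡ (k ℤ.+ e) ℤ.* (u ℤ.+ v)
  collect = solve-∀

act-cong : ∀ p {a b} → (∀ k → a k ≡ b k) → ∀ k → act p a k ≡ act p b k
act-cong p eq k = actL-cong (cs p) eq (k ℤ.- low p)

act-pad : ∀ p m → m ℤ.≤ low p → ∀ a k →
  actL (replicate ℤ.∣ low p ℤ.- m ∣ 0ℤ ++ cs p) a (k ℤ.- m) ≡ act p a k
act-pad p m m≤ a k = begin
  actL (replicate ℤ.∣ low p ℤ.- m ∣ 0ℤ ++ cs p) a (k ℤ.- m)
    ≡⟨ actL-pad ℤ.∣ low p ℤ.- m ∣ (cs p) a (k ℤ.- m) ⟩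
  actL (cs p) a ((k ℤ.- m) ℤ.- + ℤ.∣ low p ℤ.- m ∣)
    ≡⟨ cong (λ t → actL (cs p) a ((k ℤ.- m) ℤ.- t)) (ℤₚ.0≤i⇒+∣i∣≡i (ℤₚ.i≤j⇒0≤j-i m≤)) ⟩
  actL (cs p) a ((k ℤ.- m) ℤ.- (low p ℤ.- m))
    ≡⟨ cong (actL (cs p) a) (telescope k m (low p)) ⟩
  act p a k ∎
  where
  open ≡-Reasoning
  telescope : ∀ k m l → (k ℤ.- m) ℤ.- (l ℤ.- m) ≡ k ℤ.- l
  telescope = solve-∀

act-+LP : ∀ p q a k → act (p +LP q) a k ≡ act p a k ℤ.+ act q a k
act-+LP p q a k = trans (actL-addL (replicate ℤ.∣ low p ℤ.- m ∣ 0ℤ ++ cs p) _ a (k ℤ.- m))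
  (cong₂ ℤ._+_ (act-pad p m (ℤₚ.i⊓j≤i (low p) (low q)) a k)
               (act-pad q m (ℤₚ.i⊓j≤j (low p) (low q)) a k))
  where m = low p ℤ.⊓ low q

act-*LP : ∀ p q a k → act (p *LP q) a k ≡ act p (act q a) k
act-*LP p q a k = begin
  actL (mulL (cs p) (cs q)) a (k ℤ.- (low p ℤ.+ low q))
    ≡⟨ actL-mulL (cs p) (cs q) a _ ⟩
  actL (cs p) (actL (cs q) a) (k ℤ.- (low p ℤ.+ low q))
    ≡⟨ cong (actL (cs p) (actL (cs q) a)) (assoc k (low p) (low q)) ⟩
  actL (cs p) (actL (cs q) a) ((k ℤ.- low p) ℤ.- low q)
    ≡⟨ actL-shift (cs p) (actL (cs q) a) (low q) (k ℤ.- low p) ⟨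
  act p (act q a) k ∎
  where
  open ≡-Reasoning
  assoc : ∀ k l m → k ℤ.- (l ℤ.+ m) ≡ (k ℤ.- l) ℤ.- m
  assoc = solve-∀

act-comm : ∀ p q a k → act p (act q a) k ≡ act q (act p a) k
act-comm p q a k = begin
  act p (act q a) k
    ≡⟨ actL-shift (cs p) (actL (cs q) a) (low q) (k ℤ.- low p) ⟩
  actL (cs p) (actL (cs q) a) ((k ℤ.- low p) ℤ.- low q)
    ≡⟨ actL-comm (cs p) (cs q) a _ ⟩
  actL (cs q) (actL (cs p) a) ((k ℤ.- low p) ℤ.- low q)
    ≡⟨ cong (actL (cs q) (actL (cs p) a)) (swap k (low p) (low q)) ⟩
  actL (cs q) (actL (cs p) a) ((k ℤ.- low q) ℤ.- low p)
    ≡⟨ actL-shift (cs q) (actL (cs p) a) (low p) (k ℤ.- low q) ⟨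
  act q (act p a) k ∎
  where
  open ≡-Reasoning
  swap : ∀ k l m → (k ℤ.- l) ℤ.- m ≡ (k ℤ.- m) ℤ.- l
  swap = solve-∀

act-linear : ∀ p a b k → act p (λ j → a j ℤ.+ b j) k ≡ act p a k ℤ.+ act p b k
act-linear p a b k = begin
  act p (λ j → a j ℤ.+ b j) k
    ≡⟨ act-cong p (λ j → cong (ℤ._+ b j) (sym (ℤₚ.*-identityˡ (a j)))) k ⟩
  act p (λ j → 1ℤ ℤ.* a j ℤ.+ b j) k
    ≡⟨ actL-linear (cs p) 1ℤ a b (k ℤ.- low p) ⟩
  1ℤ ℤ.* act p a k ℤ.+ act p b k
    ≡⟨ cong (ℤ._+ act p b k) (ℤₚ.*-identityˡ (act p a k)) ⟩
  act p a k ℤ.+ act p b k ∎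
  where open ≡-Reasoning

act-scaleLP : ∀ c p a k → act (scaleLP c p) a k ≡ c ℤ.* act p a k
act-scaleLP c p a k = actL-scaleL c (cs p) a (k ℤ.- low p)

act-mono : ∀ c e a k → act (mono c e) a k ≡ c ℤ.* a (k ℤ.- e)
act-mono c e a k = ℤₚ.+-identityʳ _

act-1LP : ∀ a k → act 1LP a k ≡ a k
act-1LP a k = trans (act-mono 1ℤ 0ℤ a k)
  (trans (ℤₚ.*-identityˡ _) (cong a (ℤₚ.+-identityʳ k)))

act-DyLP : ∀ p a k → act (DyLP p) a k ℤ.+ act p (λ j → j ℤ.* a j) k ≡ k ℤ.* act p a k
act-DyLP p a k = trans (actL-DyAux (low p) (cs p) a (k ℤ.- low p))
  (cong (ℤ._* act p a k) (cancel k (low p)))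
  where
  cancel : ∀ k l → (k ℤ.- l) ℤ.+ l ≡ k
  cancel = solve-∀

δ : ℤ → ℤ
δ (+ zero)  = 1ℤ
δ (+ suc _) = 0ℤ
δ -[1+ _ ]  = 0ℤ

actL-δ-negative : ∀ xs n → actL xs δ -[1+ n ] ≡ 0ℤ
actL-δ-negative []       n = refl
actL-δ-negative (x ∷ xs) n = cong₂ ℤ._+_ (ℤₚ.*-zeroʳ x) (actL-δ-negative xs (suc (n ℕ.+ 0)))

actL-δ : ∀ xs n → actL xs δ (+ n) ≡ nth xs n
actL-δ []       n       = refl
actL-δ (x ∷ xs) zero    =
  trans (cong₂ ℤ._+_ (ℤₚ.*-identityʳ x) (actL-δ-negative xs 0)) (ℤₚ.+-identityʳ x)
actL-δ (x ∷ xs) (suc n) =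
  trans (cong₂ ℤ._+_ (ℤₚ.*-zeroʳ x) (actL-δ xs n)) (ℤₚ.+-identityˡ _)

coeffLP≡act-δ : ∀ p k → coeffLP p k ≡ act p δ k
coeffLP≡act-δ p k with k ℤ.- low p
... | + n      = sym (actL-δ (cs p) n)
... | -[1+ n ] = sym (actL-δ-negative (cs p) n)

-- The semiring of Laurent polynomials

infix 4 _≈LP_
-- A Laurent polynomial has many representations, by lower `low` or padded zeros. Testing on all
-- sequences identifies them and turns products into composition; the sequence `δ` recovers the
-- coefficients.
record _≈LP_ (p q : LPoly) : Set where
  constructor same
  field at : ∀ a k → act p a k ≡ act q a k
open _≈LP_

≈LP-isEquivalence : IsEquivalence _≈LP_
≈LP-isEquivalence = record
  { refl  = same λ _ _ → refl
  ; sym   = λ e → same λ a k → sym (at e a k)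
  ; trans = λ e f → same λ a k → trans (at e a k) (at f a k)
  }

+LP-cong : ∀ {p p′ q q′} → p ≈LP p′ → q ≈LP q′ → (p +LP q) ≈LP (p′ +LP q′)
+LP-cong {p} {p′} {q} {q′} e f = same λ a k →
  trans (act-+LP p q a k) (trans (cong₂ ℤ._+_ (at e a k) (at f a k)) (sym (act-+LP p′ q′ a k)))

*LP-cong : ∀ {p p′ q q′} → p ≈LP p′ → q ≈LP q′ → (p *LP q) ≈LP (p′ *LP q′)
*LP-cong {p} {p′} {q} {q′} e f = same λ a k → trans (act-*LP p q a k)
  (trans (at e (act q a) k) (trans (act-cong p′ (at f a) k) (sym (act-*LP p′ q′ a k))))

LPoly-commutativeSemiring : CommutativeSemiring 0ℓ 0ℓ
LPoly-commutativeSemiring = record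
  { Carrier = LPoly
  ; _≈_ = _≈LP_
  ; _+_ = _+LP_
  ; _*_ = _*LP_
  ; 0# = 0LP
  ; 1# = 1LP
  ; isCommutativeSemiring = isCommutativeSemiringˡ record
    { +-isCommutativeMonoid = record
      { isMonoid = record
        { isSemigroup = record
          { isMagma = record { isEquivalence = ≈LP-isEquivalence ; ∙-cong = +LP-cong }
          ; assoc = λ p q r → same λ a k → begin
              act ((p +LP q) +LP r) a k                    ≡⟨ act-+LP (p +LP q) r a k ⟩
              act (p +LP q) a k ℤ.+ act r a k              ≡⟨ cong (ℤ._+ _) (act-+LP p q a k) ⟩
              (act p a k ℤ.+ act q a k) ℤ.+ act r a k      ≡⟨ ℤₚ.+-assoc (act p a k) _ _ ⟩
              act p a k ℤ.+ (act q a k ℤ.+ act r a k)      ≡⟨ +-congˡ (act p a k) (act-+LP q r a k) ⟨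
              act p a k ℤ.+ act (q +LP r) a k              ≡⟨ act-+LP p (q +LP r) a k ⟨
              act (p +LP (q +LP r)) a k                    ∎
          }
        ; identity =
            (λ p → same λ a k → trans (act-+LP 0LP p a k) (ℤₚ.+-identityˡ _))
          , (λ p → same λ a k → trans (act-+LP p 0LP a k) (ℤₚ.+-identityʳ _))
        }
      ; comm = λ p q → same λ a k → trans (act-+LP p q a k)
          (trans (ℤₚ.+-comm (act p a k) _) (sym (act-+LP q p a k)))
      }
    ; *-isCommutativeMonoid = record
      { isMonoid = record
        { isSemigroup = record
          { isMagma = record { isEquivalence = ≈LP-isEquivalence ; ∙-cong = *LP-cong }
          ; assoc = λ p q r → same λ a k → begin
              act ((p *LP q) *LP r) a k  ≡⟨ act-*LP (p *LP q) r a k ⟩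
              act (p *LP q) (act r a) k  ≡⟨ act-*LP p q (act r a) k ⟩
              act p (act q (act r a)) k  ≡⟨ act-cong p (act-*LP q r a) k ⟨
              act p (act (q *LP r) a) k  ≡⟨ act-*LP p (q *LP r) a k ⟨
              act (p *LP (q *LP r)) a k  ∎
          }
        ; identity =
            (λ p → same λ a k → trans (act-*LP 1LP p a k) (act-1LP (act p a) k))
          , (λ p → same λ a k → trans (act-*LP p 1LP a k) (act-cong p (act-1LP a) k))
        }
      ; comm = λ p q → same λ a k → trans (act-*LP p q a k)
          (trans (act-comm p q a k) (sym (act-*LP q p a k)))
      }
    ; distribʳ = λ r p q → same λ a k → begin
        act ((p +LP q) *LP r) a k                   ≡⟨ act-*LP (p +LP q) r a k ⟩
        act (p +LP q) (act r a) k                   ≡⟨ act-+LP p q (act r a) k ⟩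
        act p (act r a) k ℤ.+ act q (act r a) k     ≡⟨ cong₂ ℤ._+_ (act-*LP p r a k) (act-*LP q r a k) ⟨
        act (p *LP r) a k ℤ.+ act (q *LP r) a k     ≡⟨ act-+LP (p *LP r) (q *LP r) a k ⟨
        act ((p *LP r) +LP (q *LP r)) a k           ∎
    ; zeroˡ = λ p → same λ a k → act-*LP 0LP p a k
    }
  }
  where open ≡-Reasoning

private module LP where
  open CommutativeSemiring LPoly-commutativeSemiring public

-- `DyLP` is defined on representations; `act-DyLP` expresses its action through that of `p` alone,
-- which makes it well defined.
DyLP-cong : ∀ {p q} → p ≈LP q → DyLP p ≈LP DyLP q
DyLP-cong {p} {q} e = same λ a k → +-cancelʳ (act p (λ j → j ℤ.* a j) k) _ _ (begin
  act (DyLP p) a k ℤ.+ act p (λ j → j ℤ.* a j) k  ≡⟨ act-DyLP p a k ⟩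
  k ℤ.* act p a k                                 ≡⟨ cong (k ℤ.*_) (at e a k) ⟩
  k ℤ.* act q a k                                 ≡⟨ act-DyLP q a k ⟨
  act (DyLP q) a k ℤ.+ act q (λ j → j ℤ.* a j) k  ≡⟨ +-congˡ (act (DyLP q) a k) (at e _ k) ⟨
  act (DyLP q) a k ℤ.+ act p (λ j → j ℤ.* a j) k  ∎)
  where open ≡-Reasoning

DyLP-+LP : ∀ p q → DyLP (p +LP q) ≈LP (DyLP p +LP DyLP q)
DyLP-+LP p q = same λ a k → let ∂a = λ j → j ℤ.* a j in
  +-cancelʳ (act (p +LP q) ∂a k) _ _ (begin
  act (DyLP (p +LP q)) a k ℤ.+ act (p +LP q) ∂a k  ≡⟨ act-DyLP (p +LP q) a k ⟩
  k ℤ.* act (p +LP q) a k                          ≡⟨ cong (k ℤ.*_) (act-+LP p q a k) ⟩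
  k ℤ.* (act p a k ℤ.+ act q a k)                  ≡⟨ ℤₚ.*-distribˡ-+ k _ _ ⟩
  k ℤ.* act p a k ℤ.+ k ℤ.* act q a k              ≡⟨ cong₂ ℤ._+_ (act-DyLP p a k) (act-DyLP q a k) ⟨
  (act (DyLP p) a k ℤ.+ act p ∂a k) ℤ.+ (act (DyLP q) a k ℤ.+ act q ∂a k)
    ≡⟨ interchange (act (DyLP p) a k) _ _ _ ⟩
  (act (DyLP p) a k ℤ.+ act (DyLP q) a k) ℤ.+ (act p ∂a k ℤ.+ act q ∂a k)
    ≡⟨ cong₂ ℤ._+_ (act-+LP (DyLP p) (DyLP q) a k) (act-+LP p q ∂a k) ⟨
  act (DyLP p +LP DyLP q) a k ℤ.+ act (p +LP q) ∂a k ∎)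
  where
  open ≡-Reasoning
  interchange : ∀ x y z w → (x ℤ.+ y) ℤ.+ (z ℤ.+ w) ≡ (x ℤ.+ z) ℤ.+ (y ℤ.+ w)
  interchange = solve-∀

-- act (DyLP p) is the commutator of multiplication by k with act p, hence the Leibniz rule.
DyLP-*LP : ∀ p q → DyLP (p *LP q) ≈LP ((DyLP p *LP q) +LP (p *LP DyLP q))
DyLP-*LP p q = same λ a k → let ∂a = λ j → j ℤ.* a j in
  +-cancelʳ (act (p *LP q) ∂a k) _ _ (begin
  act (DyLP (p *LP q)) a k ℤ.+ act (p *LP q) ∂a k  ≡⟨ act-DyLP (p *LP q) a k ⟩
  k ℤ.* act (p *LP q) a k                          ≡⟨ cong (k ℤ.*_) (act-*LP p q a k) ⟩
  k ℤ.* act p (act q a) k                          ≡⟨ act-DyLP p (act q a) k ⟨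
  act (DyLP p) (act q a) k ℤ.+ act p (λ j → j ℤ.* act q a j) k
    ≡⟨ +-congˡ (act (DyLP p) (act q a) k) (act-cong p (act-DyLP q a) k) ⟨
  act (DyLP p) (act q a) k ℤ.+ act p (λ j → act (DyLP q) a j ℤ.+ act q ∂a j) k
    ≡⟨ +-congˡ (act (DyLP p) (act q a) k) (act-linear p _ _ k) ⟩
  act (DyLP p) (act q a) k ℤ.+ (act p (act (DyLP q) a) k ℤ.+ act p (act q ∂a) k)
    ≡⟨ ℤₚ.+-assoc (act (DyLP p) (act q a) k) _ _ ⟨
  (act (DyLP p) (act q a) k ℤ.+ act p (act (DyLP q) a) k) ℤ.+ act p (act q ∂a) k
    ≡⟨ cong₂ ℤ._+_ (trans (act-+LP (DyLP p *LP q) (p *LP DyLP q) a k)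
         (cong₂ ℤ._+_ (act-*LP (DyLP p) q a k) (act-*LP p (DyLP q) a k)))
         (act-*LP p q ∂a k) ⟨
  act ((DyLP p *LP q) +LP (p *LP DyLP q)) a k ℤ.+ act (p *LP q) ∂a k ∎)
  where open ≡-Reasoning

+LP-inverseʳ : ∀ p → (p +LP scaleLP (ℤ.- 1ℤ) p) ≈LP 0LP
+LP-inverseʳ p = same λ a k → trans (act-+LP p _ a k)
  (trans (+-congˡ (act p a k) (act-scaleLP (ℤ.- 1ℤ) p a k)) (cancel (act p a k)))
  where
  cancel : ∀ u → u ℤ.+ (ℤ.- 1ℤ) ℤ.* u ≡ 0ℤ
  cancel = solve-∀

-- The semiring of power series, exactly and modulo q ^ (h + 1)

sumLP-cong : ∀ n {F G : ℕ → LPoly} → (∀ i → i ℕ.< n → F i ≈LP G i) → sumLP n F ≈LP sumLP n G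
sumLP-cong zero    e = LP.refl
sumLP-cong (suc n) e = +LP-cong (sumLP-cong n λ i i<n → e i (ℕₚ.m<n⇒m<1+n i<n)) (e n ℕₚ.≤-refl)

sumLP-zero : ∀ n {F : ℕ → LPoly} → (∀ i → F i ≈LP 0LP) → sumLP n F ≈LP 0LP
sumLP-zero zero    e = LP.refl
sumLP-zero (suc n) e = LP.trans (+LP-cong (sumLP-zero n e) (e n)) (LP.+-identityˡ 0LP)

sumLP-+ : ∀ n (F G : ℕ → LPoly) → sumLP n (λ i → F i +LP G i) ≈LP (sumLP n F +LP sumLP n G)
sumLP-+ zero    F G = LP.sym (LP.+-identityˡ 0LP)
sumLP-+ (suc n) F G = LP.trans (LP.+-congʳ (sumLP-+ n F G))
  (interchange (sumLP n F) (sumLP n G) (F n) (G n))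
  where open import Algebra.Properties.CommutativeSemigroup LP.+-commutativeSemigroup

sumLP-*ˡ : ∀ n c (F : ℕ → LPoly) → sumLP n (λ i → c *LP F i) ≈LP (c *LP sumLP n F)
sumLP-*ˡ zero    c F = LP.sym (LP.zeroʳ c)
sumLP-*ˡ (suc n) c F = LP.trans (LP.+-congʳ (sumLP-*ˡ n c F)) (LP.sym (LP.distribˡ c _ _))

sumLP-head : ∀ n (F : ℕ → LPoly) → sumLP (suc n) F ≈LP (F 0 +LP sumLP n (λ i → F (suc i)))
sumLP-head zero    F = LP.+-comm 0LP (F 0)
sumLP-head (suc n) F = LP.trans (LP.+-congʳ (sumLP-head n F)) (LP.+-assoc (F 0) _ _)

DyLP-sumLP : ∀ n (F : ℕ → LPoly) → DyLP (sumLP n F) ≈LP sumLP n (λ i → DyLP (F i))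
DyLP-sumLP zero    F = LP.refl
DyLP-sumLP (suc n) F = LP.trans (DyLP-+LP (sumLP n F) (F n)) (LP.+-congʳ (DyLP-sumLP n F))

tail : PS → PS
tail f n = f (suc n)

-- Only degrees up to n are compared, so that agreement modulo a power of q is a congruence.
*S-cong : ∀ n {f f′ g g′ : PS} → (∀ i → i ≤ n → f i ≈LP f′ i) → (∀ i → i ≤ n → g i ≈LP g′ i) →
  (f *S g) n ≈LP (f′ *S g′) n
*S-cong n e e′ = sumLP-cong (suc n) λ { i (ℕ.s≤s i≤n) → *LP-cong (e i i≤n) (e′ _ (ℕₚ.m∸n≤m n i)) }

*S-suc : ∀ f g n → (f *S g) (suc n) ≈LP ((f 0 *LP g (suc n)) +LP (tail f *S g) n)
*S-suc f g n = sumLP-head (suc n) (λ i → f i *LP g (suc n ℕ.∸ i))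

*S-sucʳ : ∀ f g n → (f *S g) (suc n) ≈LP ((f *S tail g) n +LP (f (suc n) *LP g 0))
*S-sucʳ f g zero = LP.refl
*S-sucʳ f g (suc n) = begin
  (f *S g) (suc (suc n))                                          ≈⟨ *S-suc f g (suc n) ⟩
  (f 0 *LP g (2 ℕ.+ n)) +LP (tail f *S g) (suc n)                 ≈⟨ LP.+-congˡ (*S-sucʳ (tail f) g n) ⟩
  (f 0 *LP g (2 ℕ.+ n)) +LP ((tail f *S tail g) n +LP (f (2 ℕ.+ n) *LP g 0))
                                                                  ≈⟨ LP.+-assoc _ _ _ ⟨
  ((f 0 *LP g (2 ℕ.+ n)) +LP (tail f *S tail g) n) +LP (f (2 ℕ.+ n) *LP g 0)
                                                                  ≈⟨ LP.+-congʳ (*S-suc f (tail g) n) ⟨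
  (f *S tail g) (suc n) +LP (f (2 ℕ.+ n) *LP g 0)                 ∎
  where open import Relation.Binary.Reasoning.Setoid LP.setoid

-- Peeling the first summand of f g and the last one of g f leaves the induction hypothesis for
-- `tail f` and g, so no sum has to be reversed.
*S-comm : ∀ n f g → (f *S g) n ≈LP (g *S f) n
*S-comm zero    f g = LP.+-congˡ (LP.*-comm (f 0) (g 0))
*S-comm (suc n) f g = begin
  (f *S g) (suc n)                               ≈⟨ *S-suc f g n ⟩
  (f 0 *LP g (suc n)) +LP (tail f *S g) n        ≈⟨ +LP-cong (LP.*-comm (f 0) (g (suc n))) (*S-comm n (tail f) g) ⟩
  (g (suc n) *LP f 0) +LP (g *S tail f) n        ≈⟨ LP.+-comm _ _ ⟩
  (g *S tail f) n +LP (g (suc n) *LP f 0)        ≈⟨ *S-sucʳ g f n ⟨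
  (g *S f) (suc n)                               ∎
  where open import Relation.Binary.Reasoning.Setoid LP.setoid

*S-distribʳ : ∀ n h f g → ((f +S g) *S h) n ≈LP ((f *S h) +S (g *S h)) n
*S-distribʳ n h f g = LP.trans
  (sumLP-cong (suc n) λ i _ → LP.distribʳ (h (n ℕ.∸ i)) (f i) (g i)) (sumLP-+ (suc n) _ _)

*S-scaleˡ : ∀ n c f g → ((λ i → c *LP f i) *S g) n ≈LP (c *LP (f *S g) n)
*S-scaleˡ n c f g = LP.trans
  (sumLP-cong (suc n) λ i _ → LP.*-assoc c (f i) (g (n ℕ.∸ i))) (sumLP-*ˡ (suc n) c _)

*S-head : ∀ f g → (f *S g) 0 ≈LP (f 0 *LP g 0)
*S-head f g = LP.+-identityˡ _

-- Induction on the degree through tail (f g) = f₀ tail g + (tail f) g.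
*S-assoc : ∀ n f g h → ((f *S g) *S h) n ≈LP (f *S (g *S h)) n
*S-assoc zero f g h = begin
  ((f *S g) *S h) 0           ≈⟨ *S-head (f *S g) h ⟩
  (f *S g) 0 *LP h 0          ≈⟨ LP.*-congʳ (*S-head f g) ⟩
  (f 0 *LP g 0) *LP h 0       ≈⟨ LP.*-assoc (f 0) (g 0) (h 0) ⟩
  f 0 *LP (g 0 *LP h 0)       ≈⟨ LP.*-congˡ {f 0} (*S-head g h) ⟨
  f 0 *LP (g *S h) 0          ≈⟨ *S-head f (g *S h) ⟨
  (f *S (g *S h)) 0           ∎
  where open import Relation.Binary.Reasoning.Setoid LP.setoid
*S-assoc (suc n) f g h = begin
  ((f *S g) *S h) (suc n)
    ≈⟨ *S-suc (f *S g) h n ⟩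
  ((f *S g) 0 *LP h (suc n)) +LP (tail (f *S g) *S h) n
    ≈⟨ +LP-cong (LP.*-congʳ (*S-head f g)) (*S-cong n {tail (f *S g)} {f₀g +S (tail f *S g)} {h}
         (λ i _ → *S-suc f g i) (λ _ _ → LP.refl)) ⟩
  ((f 0 *LP g 0) *LP h (suc n)) +LP ((f₀g +S (tail f *S g)) *S h) n
    ≈⟨ +LP-cong (LP.*-assoc (f 0) (g 0) (h (suc n))) (*S-distribʳ n h f₀g (tail f *S g)) ⟩
  (f 0 *LP (g 0 *LP h (suc n))) +LP ((f₀g *S h) n +LP ((tail f *S g) *S h) n)
    ≈⟨ LP.+-congˡ (+LP-cong (*S-scaleˡ n (f 0) (tail g) h) (*S-assoc n (tail f) g h)) ⟩
  (f 0 *LP (g 0 *LP h (suc n))) +LP ((f 0 *LP (tail g *S h) n) +LP (tail f *S (g *S h)) n)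
    ≈⟨ LP.+-assoc _ _ _ ⟨
  ((f 0 *LP (g 0 *LP h (suc n))) +LP (f 0 *LP (tail g *S h) n)) +LP (tail f *S (g *S h)) n
    ≈⟨ LP.+-congʳ (LP.distribˡ (f 0) _ _) ⟨
  (f 0 *LP ((g 0 *LP h (suc n)) +LP (tail g *S h) n)) +LP (tail f *S (g *S h)) n
    ≈⟨ LP.+-congʳ (LP.*-congˡ {f 0} (*S-suc g h n)) ⟨
  (f 0 *LP (g *S h) (suc n)) +LP (tail f *S (g *S h)) n
    ≈⟨ *S-suc f (g *S h) n ⟨
  (f *S (g *S h)) (suc n) ∎
  where
  open import Relation.Binary.Reasoning.Setoid LP.setoid
  f₀g : PS
  f₀g i = f 0 *LP tail g i

0S : PS
0S _ = 0LP

*S-zeroˡ : ∀ n f → (0S *S f) n ≈LP 0LP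
*S-zeroˡ n f = sumLP-zero (suc n) λ i → LP.zeroˡ (f (n ℕ.∸ i))

*S-constˡ : ∀ n c f → (constS c *S f) n ≈LP (c *LP f n)
*S-constˡ zero    c f = *S-head (constS c) f
*S-constˡ (suc n) c f = LP.trans (*S-suc (constS c) f n)
  (LP.trans (LP.+-congˡ (*S-zeroˡ n f)) (LP.+-identityʳ _))

*S-identityˡ : ∀ n f → (1S *S f) n ≈LP f n
*S-identityˡ n f = LP.trans (*S-constˡ n 1LP f) (LP.*-identityˡ (f n))

DyS-*S : ∀ n f g → DyS (f *S g) n ≈LP ((DyS f *S g) +S (f *S DyS g)) n
DyS-*S n f g = LP.trans (DyLP-sumLP (suc n) _) (LP.trans
  (sumLP-cong (suc n) λ i _ → DyLP-*LP (f i) (g (n ℕ.∸ i))) (sumLP-+ (suc n) _ _))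

finProd-stable : ∀ {F : ℕ → PS} → (∀ j n → n ℕ.< j → F j n ≈LP 1S n) →
  ∀ m {n} → n ≤ m → finProd F m n ≈LP infProd F n
finProd-stable F≈1 zero    {zero} ℕ.z≤n = LP.refl
finProd-stable {F} F≈1 (suc m) {n} n≤1+m with n ℕ.≟ suc m
... | yes refl  = LP.refl
... | no  n≢1+m = begin
  (finProd F m *S F (suc m)) n  ≈⟨ *S-cong n {finProd F m} (λ _ _ → LP.refl)
                                     (λ i i≤n → F≈1 (suc m) i (ℕₚ.≤-<-trans i≤n n<1+m)) ⟩
  (finProd F m *S 1S) n         ≈⟨ *S-comm n (finProd F m) 1S ⟩
  (1S *S finProd F m) n         ≈⟨ *S-identityˡ n (finProd F m) ⟩
  finProd F m n                 ≈⟨ finProd-stable F≈1 m (ℕₚ.≤-pred n<1+m) ⟩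
  infProd F n                   ∎
  where
  open import Relation.Binary.Reasoning.Setoid LP.setoid
  n<1+m = ℕₚ.≤∧≢⇒< n≤1+m n≢1+m

-- Equality modulo q^(h+1): the infinite products coincide with finite ones, and the coefficient of
-- q^h is still determined.
record Agree (h : ℕ) (f g : PS) : Set where
  constructor agree
  field coefficient : ∀ n → n ≤ h → f n ≈LP g n
open Agree

PS-commutativeSemiring : ℕ → CommutativeSemiring 0ℓ 0ℓ
PS-commutativeSemiring h = record
  { Carrier = PS
  ; _≈_ = Agree h
  ; _+_ = _+S_
  ; _*_ = _*S_
  ; 0# = 0S
  ; 1# = 1S
  ; isCommutativeSemiring = isCommutativeSemiringˡ record
    { +-isCommutativeMonoid = record
      { isMonoid = record
        { isSemigroup = record
          { isMagma = record
            { isEquivalence = isEquivalence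
            ; ∙-cong = λ e e′ → agree λ n n≤h → +LP-cong (coefficient e n n≤h) (coefficient e′ n n≤h)
            }
          ; assoc = λ f g k → agree λ n _ → LP.+-assoc (f n) (g n) (k n)
          }
        ; identity = (λ f → agree λ n _ → LP.+-identityˡ (f n)) , (λ f → agree λ n _ → LP.+-identityʳ (f n))
        }
      ; comm = λ f g → agree λ n _ → LP.+-comm (f n) (g n)
      }
    ; *-isCommutativeMonoid = record
      { isMonoid = record
        { isSemigroup = record
          { isMagma = record
            { isEquivalence = isEquivalence
            ; ∙-cong = λ e e′ → agree λ n n≤h → *S-cong n
                (λ i i≤n → coefficient e i (ℕₚ.≤-trans i≤n n≤h))
                (λ i i≤n → coefficient e′ i (ℕₚ.≤-trans i≤n n≤h))
            }
          ; assoc = λ f g k → agree λ n _ → *S-assoc n f g k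
          }
        ; identity = (λ f → agree λ n _ → *S-identityˡ n f)
                   , (λ f → agree λ n _ → LP.trans (*S-comm n f 1S) (*S-identityˡ n f))
        }
      ; comm = λ f g → agree λ n _ → *S-comm n f g
      }
    ; distribʳ = λ k f g → agree λ n _ → *S-distribʳ n k f g
    ; zeroˡ = λ f → agree λ n _ → *S-zeroˡ n f
    }
  }
  where
  isEquivalence : IsEquivalence (Agree h)
  isEquivalence = record
    { refl  = agree λ _ _ → LP.refl
    ; sym   = λ e → agree λ n n≤h → LP.sym (coefficient e n n≤h)
    ; trans = λ e e′ → agree λ n n≤h → LP.trans (coefficient e n n≤h) (coefficient e′ n n≤h)
    }

-- Symmetric unimodal sequences

record SymUnimodal (a : ℤ → ℤ) : Set where
  field
    symmetric   : ∀ k → a k ≡ a (ℤ.- k)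
    nonnegative : ∀ k → 0ℤ ℤ.≤ a k
    decreasing  : ∀ n → a (+ suc n) ℤ.≤ a (+ n)

-- The first alternative allows the sequence to rest at 0; by nonnegativity it cannot leave 0 again,
-- so the support is an interval.
record SymStrict (a : ℤ → ℤ) : Set where
  field
    symmetric   : ∀ k → a k ≡ a (ℤ.- k)
    nonnegative : ∀ k → 0ℤ ℤ.≤ a k
    decreasing  : ∀ n → a (+ suc n) ≡ 0ℤ ⊎ a (+ suc n) ℤ.< a (+ n)

SymStrict⇒SymUnimodal : ∀ {a} → SymStrict a → SymUnimodal a
SymStrict⇒SymUnimodal {a} A = record
  { symmetric = symmetric ; nonnegative = nonnegative ; decreasing = weaken }
  where
  open SymStrict A
  weaken : ∀ n → a (+ suc n) ℤ.≤ a (+ n)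
  weaken n with decreasing n
  ... | inj₁ e = subst (ℤ._≤ a (+ n)) (sym e) (nonnegative (+ n))
  ... | inj₂ l = ℤₚ.<⇒≤ l

module _ {a : ℤ → ℤ} (A : SymUnimodal a) where
  open SymUnimodal A

  antitone-ℕ : ∀ {m n} → m ≤ n → a (+ n) ℤ.≤ a (+ m)
  antitone-ℕ {m} m≤n = go (ℕₚ.≤⇒≤′ m≤n)
    where
    go : ∀ {n} → m ℕ.≤′ n → a (+ n) ℤ.≤ a (+ m)
    go (ℕ.≤′-reflexive refl) = ℤₚ.≤-refl
    go (ℕ.≤′-step {n} m≤n)   = ℤₚ.≤-trans (decreasing n) (go m≤n)

  even-value : ∀ k → a k ≡ a (+ ℤ.∣ k ∣)
  even-value (+ n)    = refl
  even-value -[1+ n ] = symmetric -[1+ n ]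

  antitone-∣∣ : ∀ i j → ℤ.∣ i ∣ ≤ ℤ.∣ j ∣ → a j ℤ.≤ a i
  antitone-∣∣ i j l = subst (ℤ._≤ a i) (sym (even-value j))
    (subst (a (+ ℤ.∣ j ∣) ℤ.≤_) (sym (even-value i)) (antitone-ℕ l))

  decreasing-pred : ∀ n → a (+ suc n) ℤ.≤ a (ℤ.pred (+ n))
  decreasing-pred zero    = antitone-∣∣ -[1+ 0 ] (+ 1) ℕₚ.≤-refl
  decreasing-pred (suc n) = antitone-ℕ (ℕₚ.m≤n+m n 2)

δ-symStrict : SymStrict δ
δ-symStrict = record
  { symmetric   = λ { (+ zero) → refl ; (+ suc n) → refl ; -[1+ n ] → refl }
  ; nonnegative = λ { (+ zero) → ℤ.+≤+ ℕ.z≤n ; (+ suc n) → ℤₚ.≤-refl ; -[1+ n ] → ℤₚ.≤-refl }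
  ; decreasing  = λ _ → inj₁ refl
  }

-- The action of s = (1 + y)(1 + y⁻¹).
smear : (ℤ → ℤ) → ℤ → ℤ
smear a k = (a (ℤ.suc k) ℤ.+ a k) ℤ.+ (a k ℤ.+ a (ℤ.pred k))

neg-suc : ∀ k → ℤ.- (1ℤ ℤ.+ k) ≡ (ℤ.- 1ℤ) ℤ.+ (ℤ.- k)
neg-suc = solve-∀

neg-pred : ∀ k → ℤ.- ((ℤ.- 1ℤ) ℤ.+ k) ≡ 1ℤ ℤ.+ (ℤ.- k)
neg-pred = solve-∀

module _ {a : ℤ → ℤ} (even : ∀ k → a k ≡ a (ℤ.- k)) where

  even-suc : ∀ k → a (ℤ.suc k) ≡ a (ℤ.pred (ℤ.- k))
  even-suc k = trans (even (ℤ.suc k)) (cong a (neg-suc k))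

  even-pred : ∀ k → a (ℤ.pred k) ≡ a (ℤ.suc (ℤ.- k))
  even-pred k = trans (even (ℤ.pred k)) (cong a (neg-pred k))

  smear-symmetric : ∀ k → smear a k ≡ smear a (ℤ.- k)
  smear-symmetric k = trans
    (cong₂ ℤ._+_ (cong₂ ℤ._+_ (even-suc k) (even k)) (cong₂ ℤ._+_ (even k) (even-pred k)))
    (reverse (a (ℤ.pred (ℤ.- k))) (a (ℤ.- k)) (a (ℤ.suc (ℤ.- k))))
    where
    reverse : ∀ p m q → (p ℤ.+ m) ℤ.+ (m ℤ.+ q) ≡ (q ℤ.+ m) ℤ.+ (m ℤ.+ p)
    reverse = solve-∀

+-nonnegative : ∀ {i j} → 0ℤ ℤ.≤ i → 0ℤ ℤ.≤ j → 0ℤ ℤ.≤ i ℤ.+ j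
+-nonnegative = ℤₚ.+-mono-≤

smear-nonnegative : ∀ {a} → (∀ k → 0ℤ ℤ.≤ a k) → ∀ k → 0ℤ ℤ.≤ smear a k
smear-nonnegative p k = +-nonnegative (+-nonnegative (p (ℤ.suc k)) (p k)) (+-nonnegative (p k) (p (ℤ.pred k)))

-- Both sides of the conclusion contain a(n+1) + a(n); the hypothesis compares what is left.
smear-decreasing : ∀ a n →
  a (+ suc (suc n)) ℤ.+ a (+ suc n) ℤ.≤ a (+ n) ℤ.+ a (ℤ.pred (+ n)) →
  smear a (+ suc n) ℤ.≤ smear a (+ n)
smear-decreasing a n l = subst (ℤ._≤ smear a (+ n)) (ℤₚ.+-comm (a (+ suc n) ℤ.+ a (+ n)) _)
  (ℤₚ.+-monoʳ-≤ (a (+ suc n) ℤ.+ a (+ n)) l)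

smear-symUnimodal : ∀ {a} → SymUnimodal a → SymUnimodal (smear a)
smear-symUnimodal {a} A = record
  { symmetric   = smear-symmetric symmetric
  ; nonnegative = smear-nonnegative nonnegative
  ; decreasing  = λ n → smear-decreasing a n
      (ℤₚ.+-mono-≤ (antitone-ℕ A (ℕₚ.m≤n+m n 2)) (decreasing-pred A n))
  }
  where open SymUnimodal A

-- The action of y + y⁻¹; it does not preserve unimodality, but smear after it does.
flank : (ℤ → ℤ) → ℤ → ℤ
flank a k = a (ℤ.pred k) ℤ.+ a (ℤ.suc k)

-- After the cancellation in `smear-decreasing`, a second a(n+1) + a(n) cancels. What remains is
-- a(n+3) ≤ a(n-1) and a(n+2) ≤ a(n-2), which hold because |n-1| ≤ n+3 and |n-2| ≤ n+2.
smear-flank-symUnimodal : ∀ {a} → SymUnimodal a → SymUnimodal (smear (flank a))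
smear-flank-symUnimodal {a} A = record
  { symmetric   = smear-symmetric λ k →
      trans (cong₂ ℤ._+_ (even-pred symmetric k) (even-suc symmetric k)) (ℤₚ.+-comm _ (a (ℤ.pred (ℤ.- k))))
  ; nonnegative = smear-nonnegative λ k → +-nonnegative (nonnegative (ℤ.pred k)) (nonnegative (ℤ.suc k))
  ; decreasing  = λ n → smear-decreasing (flank a) n (subst₂ ℤ._≤_
      (outer (a (+ suc n)) (a (+ n)) (a (+ suc (suc (suc n)))) (a (+ suc (suc n))))
      (inner (a (+ suc n)) (a (+ n)) (a (ℤ.pred (+ n))) (a (ℤ.pred (ℤ.pred (+ n)))) (a (ℤ.suc (ℤ.pred (+ n))))
        (cong a (ℤₚ.suc-pred (+ n))))
      (ℤₚ.+-monoʳ-≤ (a (+ suc n) ℤ.+ a (+ n))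
        (ℤₚ.+-mono-≤ (ℤₚ.≤-trans (antitone-ℕ A (ℕₚ.m≤n+m (suc n) 2)) (decreasing-pred A n))
                     (decreasing-pred² n))))
  }
  where
  open SymUnimodal A
  decreasing-pred² : ∀ n → a (+ suc (suc n)) ℤ.≤ a (ℤ.pred (ℤ.pred (+ n)))
  decreasing-pred² zero          = antitone-∣∣ A -[1+ 1 ] (+ 2) ℕₚ.≤-refl
  decreasing-pred² (suc zero)    = antitone-∣∣ A -[1+ 0 ] (+ 3) (ℕ.s≤s ℕ.z≤n)
  decreasing-pred² (suc (suc n)) = antitone-ℕ A (ℕₚ.m≤n+m n 4)
  outer : ∀ p q r t → (p ℤ.+ q) ℤ.+ (r ℤ.+ t) ≡ (p ℤ.+ r) ℤ.+ (q ℤ.+ t)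
  outer = solve-∀
  inner : ∀ p q r t q′ → q′ ≡ q → (p ℤ.+ q) ℤ.+ (r ℤ.+ t) ≡ (r ℤ.+ p) ℤ.+ (t ℤ.+ q′)
  inner p q r t .q refl = swap p q r t
    where
    swap : ∀ p q r t → (p ℤ.+ q) ℤ.+ (r ℤ.+ t) ≡ (r ℤ.+ p) ℤ.+ (t ℤ.+ q)
    swap = solve-∀

-- If a(n+1) < a(n), then a(n+2) ≤ a(n+1) < a(n) makes the comparison strict. If a(n+1) = 0 < a(n),
-- the outer pair on the left vanishes and the one on the right is positive. If both are 0, the
-- smeared value at n+1 is 0.
smear-symStrict : ∀ {a} → SymStrict a → SymStrict (smear a)
smear-symStrict {a} A = record
  { symmetric   = smear-symmetric symmetric
  ; nonnegative = smear-nonnegative nonnegative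
  ; decreasing  = strict
  }
  where
  open SymStrict A
  B = SymStrict⇒SymUnimodal A
  fromX<Z : ∀ n → a (+ suc (suc n)) ℤ.+ a (+ suc n) ℤ.< a (+ n) ℤ.+ a (ℤ.pred (+ n)) →
    smear a (+ suc n) ℤ.< smear a (+ n)
  fromX<Z n l = subst (ℤ._< smear a (+ n)) (ℤₚ.+-comm (a (+ suc n) ℤ.+ a (+ n)) _)
    (ℤₚ.+-monoʳ-< (a (+ suc n) ℤ.+ a (+ n)) l)
  vanish : ∀ n → a (+ suc n) ≡ 0ℤ → a (+ suc (suc n)) ≡ 0ℤ
  vanish n e = ℤₚ.≤-antisym
    (subst (a (+ suc (suc n)) ℤ.≤_) e (SymUnimodal.decreasing B (suc n))) (nonnegative _)
  strict : ∀ n → smear a (+ suc n) ≡ 0ℤ ⊎ smear a (+ suc n) ℤ.< smear a (+ n)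
  strict n with decreasing n
  ... | inj₂ l = inj₂ (fromX<Z n
    (ℤₚ.+-mono-<-≤ (ℤₚ.≤-<-trans (SymUnimodal.decreasing B (suc n)) l) (decreasing-pred B n)))
  ... | inj₁ e with a (+ n) ℤ.≟ 0ℤ
  ...   | yes e₀ = inj₁ (cong₂ ℤ._+_ (cong₂ ℤ._+_ (vanish n e) e) (cong₂ ℤ._+_ e e₀))
  ...   | no ≢0  = inj₂ (fromX<Z n (subst (ℤ._< a (+ n) ℤ.+ a (ℤ.pred (+ n))) (sym (cong₂ ℤ._+_ (vanish n e) e))
      (ℤₚ.+-mono-<-≤ (ℤₚ.≤∧≢⇒< (nonnegative (+ n)) (λ e′ → ≢0 (sym e′))) (nonnegative _))))

-- Unimodality on the support hull

∣∣-mono-≥0 : ∀ {i j} → 0ℤ ℤ.≤ i → i ℤ.≤ j → ℤ.∣ i ∣ ≤ ℤ.∣ j ∣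
∣∣-mono-≥0 (ℤ.+≤+ _) (ℤ.+≤+ l) = l

∣∣-anti-≤0 : ∀ {i j} → i ℤ.≤ j → j ℤ.≤ 0ℤ → ℤ.∣ j ∣ ≤ ℤ.∣ i ∣
∣∣-anti-≤0 {i} {j} i≤j j≤0 = subst₂ _≤_ (ℤₚ.∣-i∣≡∣i∣ j) (ℤₚ.∣-i∣≡∣i∣ i)
  (∣∣-mono-≥0 (ℤₚ.neg-mono-≤ j≤0) (ℤₚ.neg-mono-≤ i≤j))

∣∣-mono-<-≥0 : ∀ {i j} → 0ℤ ℤ.≤ i → i ℤ.< j → ℤ.∣ i ∣ ℕ.< ℤ.∣ j ∣
∣∣-mono-<-≥0 (ℤ.+≤+ _) (ℤ.+<+ l) = l

∣∣-anti-<-≤0 : ∀ {i j} → i ℤ.< j → j ℤ.≤ 0ℤ → ℤ.∣ j ∣ ℕ.< ℤ.∣ i ∣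
∣∣-anti-<-≤0 {i} {j} i<j j≤0 = subst₂ ℕ._<_ (ℤₚ.∣-i∣≡∣i∣ j) (ℤₚ.∣-i∣≡∣i∣ i)
  (∣∣-mono-<-≥0 (ℤₚ.neg-mono-≤ j≤0) (ℤₚ.neg-mono-< i<j))

SymUnimodal⇒Unimodal : ∀ {a} → SymUnimodal a → Unimodal a
SymUnimodal⇒Unimodal A = 0ℤ
  , (λ i j _ _ i<j j≤0 → antitone-∣∣ A j i (∣∣-anti-≤0 (ℤₚ.<⇒≤ i<j) j≤0))
  , (λ i j _ _ i<j 0≤i → antitone-∣∣ A i j (∣∣-mono-≥0 0≤i (ℤₚ.<⇒≤ i<j)))

-- Strictness needs a nonzero value at the index farther from 0. The hull gives a nonzero value at
-- least as far out on the same side, and `spread` carries it inwards.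
SymStrict⇒StrictlyUnimodal : ∀ {a} → SymStrict a → StrictlyUnimodal a
SymStrict⇒StrictlyUnimodal {a} A = 0ℤ
  , (λ { i j ((l , l≤i , al≢0) , _) _ i<j j≤0 → strict-∣∣ j i (∣∣-anti-<-≤0 i<j j≤0)
         (spread i l (∣∣-anti-≤0 l≤i (ℤₚ.≤-trans (ℤₚ.<⇒≤ i<j) j≤0)) al≢0) })
  , (λ { i j _ (_ , (r , j≤r , ar≢0)) i<j 0≤i → strict-∣∣ i j (∣∣-mono-<-≥0 0≤i i<j)
         (spread j r (∣∣-mono-≥0 (ℤₚ.≤-trans 0≤i (ℤₚ.<⇒≤ i<j)) j≤r) ar≢0) })
  where
  open SymStrict A
  B = SymStrict⇒SymUnimodal A
  spread : ∀ i j → ℤ.∣ i ∣ ≤ ℤ.∣ j ∣ → ¬ (a j ≡ 0ℤ) → ¬ (a i ≡ 0ℤ)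
  spread i j l aj≢0 ai≡0 = aj≢0 (ℤₚ.≤-antisym (subst (a j ℤ.≤_) ai≡0 (antitone-∣∣ B i j l)) (nonnegative j))
  strict-ℕ : ∀ {m n} → m ℕ.< n → ¬ (a (+ n) ≡ 0ℤ) → a (+ n) ℤ.< a (+ m)
  strict-ℕ {m} {n} m<n an≢0 with decreasing m
  ... | inj₁ e = ⊥-elim (spread (+ suc m) (+ n) m<n an≢0 e)
  ... | inj₂ l = ℤₚ.≤-<-trans (antitone-ℕ B m<n) l
  strict-∣∣ : ∀ i j → ℤ.∣ i ∣ ℕ.< ℤ.∣ j ∣ → ¬ (a j ≡ 0ℤ) → a j ℤ.< a i
  strict-∣∣ i j l aj≢0 = subst₂ ℤ._<_ (sym (even-value B j)) (sym (even-value B i))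
    (strict-ℕ l (λ e → aj≢0 (trans (even-value B j) e)))

-- Laurent polynomials and series whose action preserves the shape of a sequence

-- The closure properties shared by the weak and the strict shape; `smear` after `flank` preserves
-- only the weak one and is supplied separately.
record Shape (Q : (ℤ → ℤ) → Set) : Set where
  field
    Q-resp  : ∀ {a b} → (∀ k → a k ≡ b k) → Q a → Q b
    Q-+     : ∀ {a b} → Q a → Q b → Q (λ k → a k ℤ.+ b k)
    Q-0     : Q (λ _ → 0ℤ)
    Q-smear : ∀ {a} → Q a → Q (smear a)

symUnimodal-shape : Shape SymUnimodal
symUnimodal-shape = record
  { Q-resp = λ {a} {b} e A → let open SymUnimodal A in record
      { symmetric   = λ k → trans (sym (e k)) (trans (symmetric k) (e (ℤ.- k)))
      ; nonnegative = λ k → subst (0ℤ ℤ.≤_) (e k) (nonnegative k)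
      ; decreasing  = λ n → subst₂ ℤ._≤_ (e (+ suc n)) (e (+ n)) (decreasing n)
      }
  ; Q-+ = +-symUnimodal
  ; Q-0 = record { symmetric = λ _ → refl ; nonnegative = λ _ → ℤₚ.≤-refl ; decreasing = λ _ → ℤₚ.≤-refl }
  ; Q-smear = smear-symUnimodal
  }
  where
  +-symUnimodal : ∀ {a b} → SymUnimodal a → SymUnimodal b → SymUnimodal (λ k → a k ℤ.+ b k)
  +-symUnimodal A B = record
    { symmetric   = λ k → cong₂ ℤ._+_ (A.symmetric k) (B.symmetric k)
    ; nonnegative = λ k → +-nonnegative (A.nonnegative k) (B.nonnegative k)
    ; decreasing  = λ n → ℤₚ.+-mono-≤ (A.decreasing n) (B.decreasing n)
    }
    where
    module A = SymUnimodal A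
    module B = SymUnimodal B

symStrict-shape : Shape SymStrict
symStrict-shape = record
  { Q-resp = λ {a} {b} e A → let open SymStrict A in record
      { symmetric   = λ k → trans (sym (e k)) (trans (symmetric k) (e (ℤ.- k)))
      ; nonnegative = λ k → subst (0ℤ ℤ.≤_) (e k) (nonnegative k)
      ; decreasing  = λ n → Sum.map (trans (sym (e (+ suc n)))) (subst₂ ℤ._<_ (e (+ suc n)) (e (+ n))) (decreasing n)
      }
  ; Q-+ = +-symStrict
  ; Q-0 = record { symmetric = λ _ → refl ; nonnegative = λ _ → ℤₚ.≤-refl ; decreasing = λ _ → inj₁ refl }
  ; Q-smear = smear-symStrict
  }
  where
  +-symStrict : ∀ {a b} → SymStrict a → SymStrict b → SymStrict (λ k → a k ℤ.+ b k)
  +-symStrict {a} {b} A B = record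
    { symmetric   = λ k → cong₂ ℤ._+_ (A.symmetric k) (B.symmetric k)
    ; nonnegative = λ k → +-nonnegative (A.nonnegative k) (B.nonnegative k)
    ; decreasing  = decreasing
    }
    where
    module A = SymStrict A
    module B = SymStrict B
    module A′ = SymUnimodal (SymStrict⇒SymUnimodal A)
    module B′ = SymUnimodal (SymStrict⇒SymUnimodal B)
    decreasing : ∀ n → a (+ suc n) ℤ.+ b (+ suc n) ≡ 0ℤ ⊎ a (+ suc n) ℤ.+ b (+ suc n) ℤ.< a (+ n) ℤ.+ b (+ n)
    decreasing n with A.decreasing n | B.decreasing n
    ... | inj₂ l | _      = inj₂ (ℤₚ.+-mono-<-≤ l (B′.decreasing n))
    ... | inj₁ _ | inj₂ l = inj₂ (ℤₚ.+-mono-≤-< (A′.decreasing n) l)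
    ... | inj₁ e | inj₁ f = inj₁ (cong₂ ℤ._+_ e f)

-- Powers of q, geometric series and theta factors

yLP vLP : LPoly
yLP = mono 1ℤ 1ℤ
vLP = mono 1ℤ (ℤ.- 1ℤ)

-- Recursion on both arguments lets the shift lemmas go by induction; `qPower-coefficient` returns
-- to the Boolean form used by `onePlus`.
qPower : ℕ → PS
qPower zero    n       = 1S n
qPower (suc j) zero    = 0LP
qPower (suc j) (suc n) = qPower j n

qPower-coefficient : ∀ j n → qPower j n ≡ (if does (n ℕ.≟ j) then 1LP else 0LP)
qPower-coefficient zero    zero    = refl
qPower-coefficient zero    (suc n) = refl
qPower-coefficient (suc j) zero    = refl
qPower-coefficient (suc j) (suc n) = qPower-coefficient j n

qPower-*-below : ∀ j f {n} → n ℕ.< j → (qPower j *S f) n ≈LP 0LP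
qPower-*-below (suc j) f {zero}  _         = LP.trans (*S-head (qPower (suc j)) f) (LP.zeroˡ (f 0))
qPower-*-below (suc j) f {suc n} (ℕ.s≤s l) = LP.trans (*S-suc (qPower (suc j)) f n)
  (LP.trans (+LP-cong (LP.zeroˡ (f (suc n))) (qPower-*-below j f l)) (LP.+-identityˡ 0LP))

qPower-*-shift : ∀ j f n → (qPower j *S f) (j ℕ.+ n) ≈LP f n
qPower-*-shift zero    f n = LP.trans (*S-cong n {qPower 0} {1S} {f} (λ _ _ → LP.refl) (λ _ _ → LP.refl)) (*S-identityˡ n f)
qPower-*-shift (suc j) f n = LP.trans (*S-suc (qPower (suc j)) f (j ℕ.+ n))
  (LP.trans (+LP-cong (LP.zeroˡ (f (suc (j ℕ.+ n)))) (qPower-*-shift j f n)) (LP.+-identityˡ (f n)))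

DyS-qPower : ∀ j n → DyLP (qPower j n) ≈LP 0LP
DyS-qPower j n rewrite qPower-coefficient j n with does (n ℕ.≟ j)
... | true  = same λ a k → refl
... | false = LP.refl

-- The successor matters: the constant coefficient of `onePlus` is always 1, so at index 0 the term
-- c would be lost.
onePlus≈ : ∀ c j n → onePlus c (suc j) n ≈LP (1S +S (constS c *S qPower (suc j))) n
onePlus≈ c j zero    = LP.sym (LP.trans (LP.+-congˡ {1LP}
  (LP.trans (*S-constˡ 0 c (qPower (suc j))) (LP.zeroʳ c))) (LP.+-identityʳ 1LP))
onePlus≈ c j (suc n) = LP.sym (LP.trans (LP.+-identityˡ _)
  (LP.trans (*S-constˡ (suc n) c (qPower (suc j))) summand))
  where
  summand : (c *LP qPower j n) ≈LP (if does (suc n ℕ.≟ suc j) then c else 0LP)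
  summand rewrite qPower-coefficient j n with does (n ℕ.≟ j)
  ... | true  = LP.*-identityʳ c
  ... | false = LP.zeroʳ c

onePlus-below : ∀ c j n → n ℕ.< j → onePlus c j n ≡ 1S n
onePlus-below c j zero    _ = refl
onePlus-below c j (suc n) l rewrite dec-false (suc n ℕ.≟ j) (ℕₚ.<⇒≢ l) = refl

oneMinus+qPower : ∀ j n → (onePlus (mono (ℤ.- 1ℤ) 0ℤ) (suc j) +S qPower (suc j)) n ≈LP 1S n
oneMinus+qPower j zero    = LP.+-identityʳ 1LP
oneMinus+qPower j (suc n) rewrite qPower-coefficient j n with does (n ℕ.≟ j)
... | true  = LP.trans (LP.+-comm (mono (ℤ.- 1ℤ) 0ℤ) 1LP) (+LP-inverseʳ 1LP)
... | false = LP.+-identityʳ 0LP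

geomS-∣ : ∀ {j n} → j ∣ n → geomS j n ≡ 1LP
geomS-∣ {j} {n} d rewrite dec-true (j ∣? n) d = refl

geomS-∤ : ∀ {j n} → ¬ (j ∣ n) → geomS j n ≡ 0LP
geomS-∤ {j} {n} ¬d rewrite dec-false (j ∣? n) ¬d = refl

geomS-below : ∀ j n → n ℕ.< j → geomS j n ≡ 1S n
geomS-below j zero    _ = geomS-∣ {j} (j ∣0)
geomS-below j (suc n) l = geomS-∤ {j} (>⇒∤ l)

geomS-periodic : ∀ j n → geomS j (j ℕ.+ n) ≡ geomS j n
geomS-periodic j n with j ∣? n
... | yes d = geomS-∣ (∣m∣n⇒∣m+n ∣-refl d)
... | no ¬d = geomS-∤ (λ d → ¬d (∣m+n∣m⇒∣n d ∣-refl))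

-- This is 1 / (1 - x) = 1 + x / (1 - x): below degree j + 1 only the constant 1 occurs, and from
-- there on divisibility by j + 1 is periodic.
geomS-recursive : ∀ j n → geomS (suc j) n ≈LP (1S +S (qPower (suc j) *S geomS (suc j))) n
geomS-recursive j n with n ℕ.<? suc j
... | yes l = LP.sym (LP.trans (LP.+-congˡ {1S n} (qPower-*-below (suc j) (geomS (suc j)) l))
                (LP.trans (LP.+-identityʳ (1S n)) (LP.reflexive (sym (geomS-below (suc j) n l)))))
... | no ¬l = subst (λ n → geomS (suc j) n ≈LP (1S +S (qPower (suc j) *S geomS (suc j))) n)
                (ℕₚ.m+[n∸m]≡n (ℕₚ.≮⇒≥ ¬l)) (LP.sym (beyond (n ℕ.∸ suc j)))
  where
  beyond : ∀ m → (0LP +LP (qPower (suc j) *S geomS (suc j)) (suc j ℕ.+ m)) ≈LP geomS (suc j) (suc j ℕ.+ m)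
  beyond m = LP.trans (LP.+-identityˡ _) (LP.trans (qPower-*-shift (suc j) (geomS (suc j)) m)
    (LP.reflexive (sym (geomS-periodic (suc j) m))))

thetaFactor : ℕ → PS
thetaFactor j = (onePlus (mono (ℤ.- 1ℤ) 0ℤ) j *S onePlus yLP j) *S onePlus vLP j

thetaFactor-below : ∀ j n → n ℕ.< j → thetaFactor j n ≈LP 1S n
thetaFactor-below j n l = LP.trans
  (*S-cong n (λ i i≤n → *S-cong i (below (mono (ℤ.- 1ℤ) 0ℤ) i i≤n) (below yLP i i≤n))
    (λ i i≤n → LP.reflexive (onePlus-below vLP j i (ℕₚ.≤-<-trans i≤n l))))
  (LP.trans (*S-cong n {1S *S 1S} {1S} {1S} (λ i _ → *S-identityˡ i 1S) (λ _ _ → LP.refl)) (*S-identityˡ n 1S))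
  where
  below : ∀ c i → i ≤ n → ∀ i′ → i′ ≤ i → onePlus c j i′ ≈LP 1S i′
  below c i i≤n i′ i′≤i = LP.reflexive
    (onePlus-below c j i′ (ℕₚ.≤-<-trans (ℕₚ.≤-trans i′≤i i≤n) l))

act-1+mono : ∀ e a k → act (1LP +LP mono 1ℤ e) a k ≡ a k ℤ.+ a (k ℤ.- e)
act-1+mono e a k = trans (act-+LP 1LP (mono 1ℤ e) a k)
  (cong₂ ℤ._+_ (act-1LP a k) (trans (act-mono 1ℤ e a k) (ℤₚ.*-identityˡ _)))

act-s : ∀ a k → act ((1LP +LP yLP) *LP (1LP +LP vLP)) a k ≡ smear a k
act-s a k = begin
  act ((1LP +LP yLP) *LP (1LP +LP vLP)) a k
    ≡⟨ act-*LP (1LP +LP yLP) (1LP +LP vLP) a k ⟩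
  act (1LP +LP yLP) (act (1LP +LP vLP) a) k
    ≡⟨ act-1+mono 1ℤ (act (1LP +LP vLP) a) k ⟩
  act (1LP +LP vLP) a k ℤ.+ act (1LP +LP vLP) a (k ℤ.- 1ℤ)
    ≡⟨ cong₂ ℤ._+_ (act-1+mono (ℤ.- 1ℤ) a k) (act-1+mono (ℤ.- 1ℤ) a (k ℤ.- 1ℤ)) ⟩
  (a k ℤ.+ a (k ℤ.+ 1ℤ)) ℤ.+ (a (k ℤ.- 1ℤ) ℤ.+ a ((k ℤ.- 1ℤ) ℤ.+ 1ℤ))
    ≡⟨ cong₂ ℤ._+_ (trans (cong (λ j → a k ℤ.+ a j) (ℤₚ.+-comm k 1ℤ)) (ℤₚ.+-comm (a k) _))
         (trans (cong₂ (λ i j → a i ℤ.+ a j) (ℤₚ.+-comm k (ℤ.- 1ℤ)) (cancel k)) (ℤₚ.+-comm _ (a k))) ⟩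
  smear a k ∎
  where
  open ≡-Reasoning
  cancel : ∀ k → (k ℤ.- 1ℤ) ℤ.+ 1ℤ ≡ k
  cancel = solve-∀

act-y+v : ∀ a k → act (yLP +LP vLP) a k ≡ flank a k
act-y+v a k = trans (act-+LP yLP vLP a k) (cong₂ ℤ._+_
  (trans (act-mono 1ℤ 1ℤ a k) (trans (ℤₚ.*-identityˡ _) (cong a (ℤₚ.+-comm k (ℤ.- 1ℤ)))))
  (trans (act-mono 1ℤ (ℤ.- 1ℤ) a k) (trans (ℤₚ.*-identityˡ _) (cong a (ℤₚ.+-comm k 1ℤ)))))

act-w : ∀ a k → act (((1LP +LP yLP) *LP (1LP +LP vLP)) *LP (yLP +LP vLP)) a k ≡ smear (flank a) k
act-w a k = trans (act-*LP ((1LP +LP yLP) *LP (1LP +LP vLP)) (yLP +LP vLP) a k)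
  (trans (act-cong ((1LP +LP yLP) *LP (1LP +LP vLP)) (act-y+v a) k) (act-s (flank a) k))

-- Positivity of the generating series

module Preservation {Q : (ℤ → ℤ) → Set} (shape : Shape Q) (Q-δ : Q δ) where
  open Shape shape

  -- Positivity is a property of the operator, so products need only composition; applying the
  -- operator to `δ` gives the shape of the coefficients.
  record Preserves (p : LPoly) : Set where
    constructor preserves
    field apply : ∀ {a} → Q a → Q (act p a)
  open Preserves

  preserves-resp : ∀ {p q} → p ≈LP q → Preserves p → Preserves q
  preserves-resp e P = preserves λ {a} A → Q-resp (at e a) (apply P A)

  preserves-+ : ∀ {p q} → Preserves p → Preserves q → Preserves (p +LP q)
  preserves-+ {p} {q} P P′ = preserves λ {a} A →
    Q-resp (λ k → sym (act-+LP p q a k)) (Q-+ (apply P A) (apply P′ A))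

  preserves-* : ∀ {p q} → Preserves p → Preserves q → Preserves (p *LP q)
  preserves-* {p} {q} P P′ = preserves λ {a} A →
    Q-resp (λ k → sym (act-*LP p q a k)) (apply P (apply P′ A))

  preserves-0 : Preserves 0LP
  preserves-0 = preserves λ _ → Q-0

  preserves-1 : Preserves 1LP
  preserves-1 = preserves λ {a} A → Q-resp (λ k → sym (act-1LP a k)) A

  preserves-scale : ∀ n {p} → Preserves p → Preserves (scaleLP (+ n) p)
  preserves-scale n {p} P = preserves λ {a} A →
    Q-resp (λ k → sym (act-scaleLP (+ n) p a k)) (multiple n (apply P A))
    where
    multiple : ∀ n {a} → Q a → Q (λ k → + n ℤ.* a k)
    multiple zero    {a} A = Q-0
    multiple (suc n) {a} A = Q-resp (λ k → sym (ℤₚ.suc-* (+ n) (a k))) (Q-+ A (multiple n A))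

  preserves-if : ∀ b → Preserves (if b then 1LP else 0LP)
  preserves-if true  = preserves-1
  preserves-if false = preserves-0

  preserves-sum : ∀ n {F : ℕ → LPoly} → (∀ i → i ℕ.< n → Preserves (F i)) → Preserves (sumLP n F)
  preserves-sum zero    P = preserves-0
  preserves-sum (suc n) P = preserves-+ (preserves-sum n λ i l → P i (ℕₚ.m<n⇒m<1+n l)) (P n ℕₚ.≤-refl)

  preserves-s : Preserves ((1LP +LP yLP) *LP (1LP +LP vLP))
  preserves-s = preserves λ {a} A → Q-resp (λ k → sym (act-s a k)) (Q-smear A)

  coefficients : ∀ {p} → Preserves p → Q (coeffLP p)
  coefficients {p} P = Q-resp (λ k → sym (coeffLP≡act-δ p k)) (apply P Q-δ)

  module Series (h : ℕ) where
    open CommutativeSemiring (PS-commutativeSemiring h) using (_≈_)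
      renaming (refl to ≈-refl; sym to ≈-sym; trans to ≈-trans; *-cong to *-cong-≈; *-congˡ to *-congˡ-≈;
        *-congʳ to *-congʳ-≈; *-identityʳ to *-identityʳ-≈; *-assoc to *-assoc-≈; distribˡ to distribˡ-≈;
        +-congˡ to +-congˡ-≈; setoid to ≈-setoid)

    record Positive (f : PS) : Set where
      constructor positive
      field coefficientwise : ∀ n → n ≤ h → Preserves (f n)
    open Positive

    positive-resp : ∀ {f g} → f ≈ g → Positive f → Positive g
    positive-resp e P = positive λ n l → preserves-resp (coefficient e n l) (coefficientwise P n l)

    positive-+ : ∀ {f g} → Positive f → Positive g → Positive (f +S g)
    positive-+ P P′ = positive λ n l → preserves-+ (coefficientwise P n l) (coefficientwise P′ n l)

    positive-* : ∀ {f g} → Positive f → Positive g → Positive (f *S g)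
    positive-* P P′ = positive λ n n≤h → preserves-sum (suc n) λ { i (ℕ.s≤s i≤n) → preserves-*
      (coefficientwise P i (ℕₚ.≤-trans i≤n n≤h))
      (coefficientwise P′ (n ℕ.∸ i) (ℕₚ.≤-trans (ℕₚ.m∸n≤m n i) n≤h)) }

    positive-const : ∀ {c} → Preserves c → Positive (constS c)
    positive-const P = positive λ { zero _ → P ; (suc n) _ → preserves-0 }

    positive-0 : Positive 0S
    positive-0 = positive λ _ _ → preserves-0

    positive-1 : Positive 1S
    positive-1 = positive-const preserves-1

    positive-^ : ∀ {f} m → Positive f → Positive (f ^S m)
    positive-^ zero    P = positive-1
    positive-^ (suc m) P = positive-* P (positive-^ m P)

    positive-geomS : ∀ j → Positive (geomS j)
    positive-geomS j = positive λ n _ → preserves-if (does (j ∣? n))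

    positive-qPower : ∀ j → Positive (qPower j)
    positive-qPower j = positive λ n _ →
      subst Preserves (sym (qPower-coefficient j n)) (preserves-if (does (n ℕ.≟ j)))

    constS-+ : ∀ c d → (constS c +S constS d) ≈ constS (c +LP d)
    constS-+ c d = agree λ { zero _ → LP.refl ; (suc n) _ → LP.+-identityˡ 0LP }

    constS-* : ∀ c d → (constS c *S constS d) ≈ constS (c *LP d)
    constS-* c d = agree λ { zero _ → *S-constˡ 0 c (constS d)
                           ; (suc n) _ → LP.trans (*S-constˡ (suc n) c (constS d)) (LP.zeroʳ c) }

    y v s : PS
    y = constS yLP
    v = constS vLP
    s = (1S +S y) *S (1S +S v)

    s≈const : s ≈ constS ((1LP +LP yLP) *LP (1LP +LP vLP))
    s≈const = ≈-trans (*-cong-≈ (constS-+ 1LP yLP) (constS-+ 1LP vLP)) (constS-* _ _)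

    positive-s : Positive s
    positive-s = positive-resp (≈-sym s≈const) (positive-const preserves-s)

    DyS-isDerivation : IsDerivation (PS-commutativeSemiring h) (scaleS (ℤ.- 1ℤ)) DyS
    DyS-isDerivation = record
      { neg-inverseʳ = λ f → agree λ n _ → +LP-inverseʳ (f n)
      ; D-cong       = λ e → agree λ n l → DyLP-cong (coefficient e n l)
      ; D-+          = λ f g → agree λ n _ → DyLP-+LP (f n) (g n)
      ; D-*          = λ f g → agree λ n _ → DyS-*S n f g
      }

    DyS-y : DyS y ≈ y
    DyS-y = agree λ { zero _ → LP.refl ; (suc n) _ → LP.refl }

    v+DyS-v : (v +S DyS v) ≈ 0S
    v+DyS-v = agree λ { zero _ → +LP-inverseʳ vLP ; (suc n) _ → LP.+-identityˡ 0LP }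

    open LogDerivative (PS-commutativeSemiring h) DyS-isDerivation
    open Theta y v (constS-* yLP vLP) DyS-y v+DyS-v
      Positive positive-resp positive-+ positive-* positive-0 positive-1 positive-s
      hiding (s)

    positive-w : (∀ {a} → Q a → Q (smear (flank a))) → Positive w
    positive-w smear-flank = positive-resp
      (≈-sym (≈-trans (*-cong-≈ s≈const (constS-+ yLP vLP)) (constS-* _ _)))
      (positive-const (preserves λ {a} A → Q-resp (λ k → sym (act-w a k)) (smear-flank A)))

    oneMinus : ℕ → PS
    oneMinus j = onePlus (mono (ℤ.- 1ℤ) 0ℤ) (suc j)

    oneMinus+q≈1 : ∀ j → (oneMinus j +S qPower (suc j)) ≈ 1S
    oneMinus+q≈1 j = agree λ n _ → oneMinus+qPower j n

    -- Adding g x to g (1 - x) gives g, and the recursion for g says g = 1 + x g.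
    geomS-inverse : ∀ j → (geomS (suc j) *S oneMinus j) ≈ 1S
    geomS-inverse j = +-cancelʳ-≈ (g *S x) (begin
      (g *S oneMinus j) +S (g *S x)  ≈⟨ distribˡ-≈ g (oneMinus j) x ⟨
      g *S (oneMinus j +S x)         ≈⟨ *-congˡ-≈ {g} (oneMinus+q≈1 j) ⟩
      g *S 1S                        ≈⟨ *-identityʳ-≈ g ⟩
      g                              ≈⟨ agree (λ n _ → geomS-recursive j n) ⟩
      1S +S (x *S g)                 ≈⟨ +-congˡ-≈ {1S} (agree λ n _ → *S-comm n x g) ⟩
      1S +S (g *S x)                 ∎)
      where
      open import Relation.Binary.Reasoning.Setoid ≈-setoid
      g = geomS (suc j)
      x = qPower (suc j)

    open Product {λ j → qPower (suc j)} {oneMinus} {λ j → geomS (suc j)}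
      oneMinus+q≈1 geomS-inverse (λ j → agree λ n _ → DyS-qPower (suc j) n)
      (λ j → positive-qPower (suc j)) (λ j → positive-geomS (suc j))

    thetaFactor≈L : ∀ j → thetaFactor (suc j) ≈ L j
    thetaFactor≈L j = *-cong-≈ (*-congˡ-≈ {oneMinus j} (agree λ n _ → onePlus≈ yLP j n))
      (agree λ n _ → onePlus≈ vLP j n)

    finProd≈∏ : ∀ {F G : ℕ → PS} → (∀ j → F (suc j) ≈ G j) → ∀ m → finProd F m ≈ ∏ G m
    finProd≈∏ e zero    = ≈-refl
    finProd≈∏ e (suc m) = *-cong-≈ (finProd≈∏ e m) (e m)

    infProd≈∏ : ∀ {F G : ℕ → PS} → (∀ j n → n ℕ.< j → F j n ≈LP 1S n) →
      (∀ j → F (suc j) ≈ G j) → infProd F ≈ ∏ G h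
    infProd≈∏ F≈1 e = ≈-trans (agree λ n l → LP.sym (finProd-stable F≈1 h l)) (finProd≈∏ e h)

    qPochInv≈ : qPochInv ≈ ∏ (λ j → geomS (suc j)) h
    qPochInv≈ = infProd≈∏ (λ j n l → LP.reflexive (geomS-below j n l)) (λ _ → ≈-refl)

    thetaT≈ : thetaT ≈ ((1S +S y) *S ∏ L h)
    thetaT≈ = *-cong-≈ (≈-sym (constS-+ 1LP yLP)) (infProd≈∏ thetaFactor-below thetaFactor≈L)

    ^S-suc : ∀ f n → (f ^S suc n) ≈ (f *S (f ^S n))
    ^S-suc f n = agree λ _ _ → LP.refl

    ^3≈cube : ∀ f → (f ^S 3) ≈ cube f
    ^3≈cube f = *-congˡ-≈ {f} (*-congˡ-≈ {f} (*-identityʳ-≈ f))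

    ^6≈square-cube : ∀ f → (f ^S 6) ≈ square (cube f)
    ^6≈square-cube f = ≈-sym (begin
      (f *S (f *S f)) *S cube f         ≈⟨ *-assoc-≈ f (f *S f) (cube f) ⟩
      f *S ((f *S f) *S cube f)         ≈⟨ *-congˡ-≈ {f} (*-assoc-≈ f f (cube f)) ⟩
      f *S (f *S (f *S cube f))         ≈⟨ *-congˡ-≈ {f} (*-congˡ-≈ {f} (*-congˡ-≈ {f} (^3≈cube f))) ⟨
      f *S (f *S (f *S (f ^S 3)))       ∎)
      where open import Relation.Binary.Reasoning.Setoid ≈-setoid

    positive-∏ : ∀ {F} → (∀ j → Positive (F j)) → ∀ m → Positive (∏ F m)
    positive-∏ P zero    = positive-1
    positive-∏ P (suc m) = positive-* (positive-∏ P m) (P m)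

    positive-qEtaInv24 : Positive qEtaInv24
    positive-qEtaInv24 = positive-^ {qPochInv} 24 (positive-resp (≈-sym qPochInv≈) (positive-∏ (λ j → positive-geomS (suc j)) h))

    -- This series is ϑ₁² / η⁶ itself: the fractional powers of q cancel, and `v` is the y⁻¹ left by
    -- the two factors y^(-1/2).
    positive-ratio² : Positive (v *S square (thetaT *S (qPochInv ^S 3)))
    positive-ratio² = positive-resp
      (*-congˡ-≈ {v} {square (thetaT *S cube qPochInv)} {square (thetaT *S (qPochInv ^S 3))}
        (*-cong-≈ cube≈^3 cube≈^3))
      (P-ratio² h {qPochInv} {thetaT} qPochInv≈ thetaT≈)
      where
      cube≈^3 : (thetaT *S cube qPochInv) ≈ (thetaT *S (qPochInv ^S 3))
      cube≈^3 = *-congˡ-≈ {thetaT} {cube qPochInv} {qPochInv ^S 3} (≈-sym (^3≈cube qPochInv))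

    -- `H thetaT` unfolds to the bracket in `Gser`, so only the two forms of the sixth power have to
    -- be matched.
    Gser≈ : (v *S (square (cube qPochInv) *S H thetaT)) ≈ Gser
    Gser≈ = *-cong-≈ {v} {v} {square (cube qPochInv) *S H thetaT} {(qPochInv ^S 6) *S H thetaT} ≈-refl
      (*-congʳ-≈ {H thetaT} {square (cube qPochInv)} {qPochInv ^S 6} (≈-sym (^6≈square-cube qPochInv)))

    positive-Gser : (∀ {a} → Q a → Q (smear (flank a))) → Positive Gser
    positive-Gser smear-flank = positive-resp Gser≈
      (P-G h {qPochInv} {thetaT} qPochInv≈ thetaT≈ (positive-w smear-flank))

    mono-neg : ℕ → PS
    mono-neg e = constS (mono 1ℤ (ℤ.- (+ e)))

    mono-neg-suc : ∀ e → mono-neg (suc e) ≈ (v *S mono-neg e)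
    mono-neg-suc e = ≈-sym (subst (λ k → (v *S mono-neg e) ≈ constS (mono 1ℤ k))
      (sym (ℤₚ.neg-distrib-+ 1ℤ (+ e))) (constS-* vLP (mono 1ℤ (ℤ.- (+ e)))))

    ^S-even-suc : ∀ f e → (f ^S (2 ℕ.* suc e)) ≈ (f *S (f *S (f ^S (2 ℕ.* e))))
    ^S-even-suc f e = subst (λ m → (f ^S m) ≈ (f *S (f *S (f ^S (2 ℕ.* e))))) (sym (ℕₚ.*-suc 2 e))
      (≈-trans (^S-suc f (suc (2 ℕ.* e))) (*-congˡ-≈ {f} (^S-suc f (2 ℕ.* e))))

    positive-thetaRatioPow : ∀ e → Positive (thetaRatioPow (suc e))
    positive-thetaRatioPow e = subst
      (λ m → Positive (mono-neg e *S (f ^S m)))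
      -- Once 2 (e + 1) is written as 2 + 2e, the truncated subtraction in the exponent computes to
      -- 2e.
      (cong (ℕ._∸ 2) (sym (ℕₚ.*-suc 2 e)))
      (P-even-power {f} positive-ratio² {mono-neg} {λ e → f ^S (2 ℕ.* e)} ≈-refl mono-neg-suc ≈-refl (^S-even-suc f) e)
      where
      f : PS
      f = thetaT *S (qPochInv ^S 3)

    -- The operator q d/dq multiplies the coefficient of q^n by the natural number n, a repeated
    -- addition.
    positive-DqS : ∀ {f} → Positive f → Positive (DqS f)
    positive-DqS P = positive λ n l → preserves-scale n (coefficientwise P n l)

    positive-scaleS : ∀ c {f} → Positive f → Positive (scaleS (+ c) f)
    positive-scaleS c P = positive λ n l → preserves-scale c (coefficientwise P n l)

    coefficients-at-h : ∀ {f} → Positive f → Q (coeffLP (f h))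
    coefficients-at-h P = coefficients (coefficientwise P h ℕₚ.≤-refl)

-- The three families of invariants

N-symStrict : ∀ e h → SymStrict (N (suc e) h)
N-symStrict e h = coefficients-at-h (positive-* positive-qEtaInv24 (positive-thetaRatioPow e))
  where
  open Preservation symStrict-shape δ-symStrict
  open Series h

module _ (e h : ℕ) where
  open Preservation symUnimodal-shape (SymStrict⇒SymUnimodal δ-symStrict)
  open Series h

  positive-G^e : Positive (Gser ^S e)
  positive-G^e = positive-^ e (positive-Gser smear-flank-symUnimodal)

  N1-symUnimodal : SymUnimodal (N1 (suc e) h)
  N1-symUnimodal = coefficients-at-h (positive-* positive-qEtaInv24 positive-G^e)

  N3-symUnimodal : SymUnimodal (N3 (suc e) h)
  N3-symUnimodal = coefficients-at-h
    (positive-scaleS (catFactor (suc e)) (positive-* positive-qEtaInv24 (positive-DqS positive-G^e)))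

theorem5p5 : (d h : ℕ) → 2 ≤ d →
    (Symmetric (N d h) × StrictlyUnimodal (N d h)) ×
    (Symmetric (N1 d h) × Unimodal (N1 d h)) ×
    (Symmetric (N3 d h) × Unimodal (N3 d h))
theorem5p5 (suc e) h 2≤d =
    (SymStrict.symmetric N-shape , SymStrict⇒StrictlyUnimodal N-shape)
  , (SymUnimodal.symmetric N1-shape , SymUnimodal⇒Unimodal N1-shape)
  , (SymUnimodal.symmetric N3-shape , SymUnimodal⇒Unimodal N3-shape)
  where
  N-shape  = N-symStrict e h
  N1-shape = N1-symUnimodal e h
  N3-shape = N3-symUnimodal e h
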